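{- Let $2<s\leq 3$. For all sufficiently large $n$ there exists a function $f\colon\mathbb{F}_2^n\to\mathbb{F}_2$ of degree $3$ with algebraic thickness $\mathcal{T}(f)\leq n^{s}$ that is nonconstant on every flat $E\subseteq\mathbb{F}_2^n$ of dimension at least $6.12\,n^{2-\frac{s}{2}}$.
   Context: Every $f\colon\mathbb{F}_2^n\to\mathbb{F}_2$ is uniquely a multilinear polynomial over $\mathbb{F}_2$ (its algebraic normal form): $f(x)=\sum_{S\subseteq[n]}c_S\prod_{j\in S}x_j$ with $c_S\in\{0,1\}$ and $[n]=\{1,\dots,n\}$. The degree of $f$ is the largest $|S|$ with $c_S=1$, and the sparsity $\|f\|$ is the number of $S$ with $c_S=1$. The algebraic thickness is $\mathcal{T}(f)=\min_{A\in\mathcal{A}_n}\|f\circ A\|$, where $\mathcal{A}_n$ is the set of affine bijections $\mathbb{F}_2^n\to\mathbb{F}_2^n$. A $k$-dimensional flat is an affine subspace of $\mathbb{F}_2^n$ of dimension $k$. -}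

module Defs where

open import Algebra.Definitions.RawSemiring using (_^_)
open import Data.Bool.Base using (Bool; true; false; _∧_; _xor_; if_then_else_)
open import Data.Bool.Properties
  using (∧-zeroʳ; xor-assoc; xor-identityʳ; xor-same)
open import Data.Fin.Subset using (Subset; inside; outside; ∣_∣)
open import Data.Integer.Base as ℤ using (ℤ; +_; -[1+_])
open import Data.List.Base as List using (List; []; _∷_; _++_; length; filterᵇ)
open import Data.List.Extrema.Nat using (max)
open import Data.List.Properties using (map-++)
open import Data.Nat.Base as ℕ using (ℕ; zero; suc)
import Data.Nat.Properties as ℕ
open import Data.Product.Base using (Σ; ∃; ∃-syntax; _×_; _,_)
open import Data.Rational.Base as ℚ using (ℚ; 0ℚ; Positive; ↥_; ↧ₙ_; _/_)
open import Data.Sum.Base using (_⊎_)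
open import Data.Vec.Base as Vec using (Vec; []; _∷_; zipWith; replicate; map)
open import Function.Base using (_∘_)
open import Function.Bundles using (_⇔_)
open import Function.Definitions using (Bijective)
open import Level using (0ℓ)
open import Relation.Binary.PropositionalEquality
open import Relation.Nullary.Negation using (¬_)
open import Relation.Unary using (Pred)

------------------------------------------------------------------------
-- The vector space 𝔽₂ⁿ, with _xor_ and _∧_ as the field operations

𝔽₂ : Set
𝔽₂ = Bool

𝔽₂^_ : ℕ → Set
𝔽₂^ n = Vec 𝔽₂ n

infixl 6 _⊕_
_⊕_ : ∀ {n} → 𝔽₂^ n → 𝔽₂^ n → 𝔽₂^ n
_⊕_ = zipWith _xor_

𝟎 : ∀ {n} → 𝔽₂^ n
𝟎 = replicate _ false

infixr 7 _∙_
_∙_ : ∀ {n} → 𝔽₂ → 𝔽₂^ n → 𝔽₂^ n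
a ∙ v = map (a ∧_) v

dot : ∀ {n} → 𝔽₂^ n → 𝔽₂^ n → 𝔽₂
dot u v = Vec.foldr′ _xor_ false (zipWith _∧_ u v)

combination : ∀ {k n} → 𝔽₂^ k → Vec (𝔽₂^ n) k → 𝔽₂^ n
combination c vs = Vec.foldr′ _⊕_ 𝟎 (zipWith _∙_ c vs)

LinearlyIndependent : ∀ {k n} → Vec (𝔽₂^ n) k → Set
LinearlyIndependent vs = ∀ c → combination c vs ≡ 𝟎 → c ≡ 𝟎

-- E is a translate of a linear subspace with a basis of k vectors.
IsFlat : ∀ {n} → ℕ → Pred (𝔽₂^ n) 0ℓ → Set
IsFlat {n} k E = ∃[ a ] Σ (Vec (𝔽₂^ n) k) λ vs →
  LinearlyIndependent vs × (∀ x → E x ⇔ (∃[ c ] x ≡ a ⊕ combination c vs))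

NonconstantOn : ∀ {n} → Pred (𝔽₂^ n) 0ℓ → (𝔽₂^ n → 𝔽₂) → Set
NonconstantOn E f = ∃[ x ] ∃[ y ] E x × E y × f x ≢ f y

record AffineBijection (n : ℕ) : Set where
  field
    matrix : Vec (𝔽₂^ n) n   -- list of rows
    shift  : 𝔽₂^ n

  apply : 𝔽₂^ n → 𝔽₂^ n
  apply x = map (λ row → dot row x) matrix ⊕ shift

  field
    bijective : Bijective _≡_ _≡_ apply

open AffineBijection public using (apply)

------------------------------------------------------------------------
-- Algebraic normal form

subsets : ∀ n → List (Subset n)
subsets zero    = [] ∷ []
subsets (suc n) =
  List.map (outside ∷_) (subsets n) ++ List.map (inside ∷_) (subsets n)

monomial : ∀ {n} → Subset n → 𝔽₂^ n → 𝔽₂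
monomial S x = Vec.foldr′ _∧_ true (zipWith (λ s xⱼ → if s then xⱼ else true) S x)

⨁ : List 𝔽₂ → 𝔽₂
⨁ = List.foldr _xor_ false

-- The multilinear polynomial ∑_S c_S ∏_{j ∈ S} x_j.
eval : ∀ {n} → (Subset n → 𝔽₂) → 𝔽₂^ n → 𝔽₂
eval {n} c x = ⨁ (List.map (λ S → c S ∧ monomial S x) (subsets n))

-- Computed from f(x₁, x′) = f(0, x′) + x₁ (f(0, x′) + f(1, x′)).  That these
-- are the unique coefficients representing f is eval-anf and anf-unique.
anf : ∀ {n} → (𝔽₂^ n → 𝔽₂) → Subset n → 𝔽₂
anf f []            = f []
anf f (outside ∷ S) = anf (λ x → f (false ∷ x)) S
anf f (inside  ∷ S) = anf (λ x → f (false ∷ x) xor f (true ∷ x)) S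

private
  ⨁-++ : ∀ as bs → ⨁ (as ++ bs) ≡ ⨁ as xor ⨁ bs
  ⨁-++ []       bs = refl
  ⨁-++ (a ∷ as) bs =
    trans (cong (a xor_) (⨁-++ as bs)) (sym (xor-assoc a (⨁ as) (⨁ bs)))

  ⨁-map-map : ∀ {A B : Set} (f : A → B) (g : B → 𝔽₂) (h : A → 𝔽₂) →
              (∀ a → g (f a) ≡ h a) → ∀ as →
              ⨁ (List.map g (List.map f as)) ≡ ⨁ (List.map h as)
  ⨁-map-map f g h eq []       = refl
  ⨁-map-map f g h eq (a ∷ as) = cong₂ _xor_ (eq a) (⨁-map-map f g h eq as)

  ⨁-map-false : ∀ {A : Set} (g : A → 𝔽₂) → (∀ a → g a ≡ false) →
                ∀ as → ⨁ (List.map g as) ≡ false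
  ⨁-map-false g eq []       = refl
  ⨁-map-false g eq (a ∷ as) = cong₂ _xor_ (eq a) (⨁-map-false g eq as)

  xor-cancel : ∀ a b → a xor (a xor b) ≡ b
  xor-cancel a b = trans (sym (xor-assoc a a b)) (cong (_xor b) (xor-same a))

eval-∷ : ∀ {n} (c : Subset (suc n) → 𝔽₂) b (x : 𝔽₂^ n) →
         eval c (b ∷ x) ≡ eval (c ∘ (outside ∷_)) x xor (b ∧ eval (c ∘ (inside ∷_)) x)
eval-∷ {n} c b x = trans (cong ⨁ (map-++ g (List.map (outside ∷_) (subsets n)) _))
  (trans (⨁-++ (List.map g (List.map (outside ∷_) (subsets n))) _)
    (cong₂ _xor_ (⨁-map-map (outside ∷_) g _ (λ _ → refl) (subsets n)) (ins b)))
  where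
  g : Subset (suc n) → 𝔽₂
  g S = c S ∧ monomial S (b ∷ x)
  ins : ∀ b → ⨁ (List.map (λ S → c S ∧ monomial S (b ∷ x))
                          (List.map (inside ∷_) (subsets n)))
            ≡ b ∧ eval (c ∘ (inside ∷_)) x
  ins true  = ⨁-map-map (inside ∷_) _ _ (λ _ → refl) (subsets n)
  ins false = trans (⨁-map-map (inside ∷_) _ (λ _ → false) (λ S → ∧-zeroʳ (c (inside ∷ S))) (subsets n))
                    (⨁-map-false _ (λ _ → refl) (subsets n))

eval-anf : ∀ {n} (f : 𝔽₂^ n → 𝔽₂) x → eval (anf f) x ≡ f x
eval-anf f [] with f []
... | true  = refl
... | false = refl
eval-anf f (b ∷ x) = trans (eval-∷ (anf f) b x)
  (trans (cong₂ (λ p q → p xor (b ∧ q)) (eval-anf (λ x → f (false ∷ x)) x) (eval-anf _ x))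
         (step b))
  where
  step : ∀ b → f (false ∷ x) xor (b ∧ (f (false ∷ x) xor f (true ∷ x))) ≡ f (b ∷ x)
  step true  = xor-cancel (f (false ∷ x)) _
  step false = xor-identityʳ _

anf-unique : ∀ {n} (f : 𝔽₂^ n → 𝔽₂) (c : Subset n → 𝔽₂) →
             (∀ x → eval c x ≡ f x) → ∀ S → c S ≡ anf f S
anf-unique f c eq [] = trans (lem (c [])) (eq [])
  where
  lem : ∀ b → b ≡ (b ∧ true) xor false
  lem true  = refl
  lem false = refl
anf-unique f c eq (outside ∷ S) = anf-unique _ (c ∘ (outside ∷_))
  (λ x → trans (sym (trans (eval-∷ c false x) (xor-identityʳ (eval (c ∘ (outside ∷_)) x)))) (eq (false ∷ x))) S
anf-unique f c eq (inside ∷ S) = anf-unique _ (c ∘ (inside ∷_))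
  (λ x → sym (trans
    (cong₂ _xor_
      (trans (sym (eq (false ∷ x))) (trans (eval-∷ c false x) (xor-identityʳ (eval (c ∘ (outside ∷_)) x))))
      (trans (sym (eq (true ∷ x))) (eval-∷ c true x)))
    (xor-cancel (eval (c ∘ (outside ∷_)) x) _))) S

support : ∀ {n} → (𝔽₂^ n → 𝔽₂) → List (Subset n)
support {n} f = filterᵇ (anf f) (subsets n)

-- The zero function is given degree 0.
degree : ∀ {n} → (𝔽₂^ n → 𝔽₂) → ℕ
degree f = max 0 (List.map ∣_∣ (support f))

sparsity : ∀ {n} → (𝔽₂^ n → 𝔽₂) → ℕ
sparsity f = length (support f)

-- t = min { ‖f ∘ A‖ : A an affine bijection }
IsThickness : ∀ {n} → (𝔽₂^ n → 𝔽₂) → ℕ → Set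
IsThickness {n} f t =
  (∃[ A ] sparsity (f ∘ apply A) ≡ t) ×
  (∀ (A : AffineBijection n) → t ℕ.≤ sparsity (f ∘ apply A))

------------------------------------------------------------------------
-- Real numbers as two-sided Dedekind cuts of ℚ

-- lower q means q < x, upper q means x < q.
record Cut : Set₁ where
  field
    lower : Pred ℚ 0ℓ
    upper : Pred ℚ 0ℓ

open Cut public

record IsReal (x : Cut) : Set where
  field
    lower-inhabited : ∃ (lower x)
    upper-inhabited : ∃ (upper x)
    lower-rounded   : ∀ q → lower x q ⇔ (∃[ r ] q ℚ.< r × lower x r)
    upper-rounded   : ∀ q → upper x q ⇔ (∃[ r ] r ℚ.< q × upper x r)
    disjoint        : ∀ q → ¬ (lower x q × upper x q)
    located         : ∀ p q → p ℚ.< q → lower x p ⊎ upper x q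

infix 4 _<ᶜ_ _≤ᶜ_
_<ᶜ_ : Cut → Cut → Set
x <ᶜ y = ∃[ q ] upper x q × lower y q

_≤ᶜ_ : Cut → Cut → Set
x ≤ᶜ y = ∀ q → lower x q → lower y q

fromℚ : ℚ → Cut
fromℚ p = record { lower = ℚ._< p ; upper = p ℚ.<_ }

fromℕ : ℕ → Cut
fromℕ m = fromℚ (+ m / 1)

infixl 6 _-ᶜ_
_-ᶜ_ : Cut → Cut → Cut
x -ᶜ y = record
  { lower = λ q → ∃[ a ] ∃[ b ] lower x a × upper y b × q ≡ a ℚ.- b
  ; upper = λ q → ∃[ a ] ∃[ b ] upper x a × lower y b × q ≡ a ℚ.- b
  }

infixr 7 _·ᶜ_
_·ᶜ_ : (p : ℚ) .{{_ : Positive p}} → Cut → Cut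
p ·ᶜ x = record
  { lower = λ q → ∃[ r ] lower x r × q ≡ p ℚ.* r
  ; upper = λ q → ∃[ r ] upper x r × q ≡ p ℚ.* r
  }

infixr 8 _^ℤ_
_^ℤ_ : (n : ℕ) .{{_ : ℕ.NonZero n}} → ℤ → ℚ
n ^ℤ (+ k)    = + (n ℕ.^ k) / 1
n ^ℤ -[1+ k ] = _/_ (+ 1) (n ℕ.^ suc k) {{ℕ.m^n≢0 n (suc k)}}

infixr 8 _^ℚ_
_^ℚ_ : ℚ → ℕ → ℚ
_^ℚ_ = _^_ ℚ.+-*-rawSemiring

-- q < n^r and n^r < q for rational r = a/d: compare q^d with n^a, taking
-- account of the sign of q.
_<[_^_] : ℚ → (n : ℕ) .{{_ : ℕ.NonZero n}} → ℚ → Set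
q <[ n ^ r ] = q ℚ.< 0ℚ ⊎ q ^ℚ (↧ₙ r) ℚ.< n ^ℤ (↥ r)

[_^_]<_ : (n : ℕ) .{{_ : ℕ.NonZero n}} → ℚ → ℚ → Set
[ n ^ r ]< q = 0ℚ ℚ.< q × n ^ℤ (↥ r) ℚ.< q ^ℚ (↧ₙ r)

-- As n ≥ 1, n^x is the supremum of n^r over rational r < x and the infimum
-- of n^r over rational r > x.
infixr 8 _^ᶜ_
_^ᶜ_ : (n : ℕ) .{{_ : ℕ.NonZero n}} → Cut → Cut
n ^ᶜ x = record
  { lower = λ q → ∃[ r ] lower x r × q <[ n ^ r ]
  ; upper = λ q → ∃[ r ] upper x r × [ n ^ r ]< q
  }

{-# OPTIONS --safe #-}

-- Split the n variables into B ≈ n/m blocks of size m ≈ n^{(s-1)/2} and take f to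
-- be a sum of cubic forms, one in the variables of each block; f has at most n m²
-- monomials, even before any change of coordinates.  On a flat with pivot set P,
-- the monomials supported in P restrict to linearly independent functions, so f
-- can be constant for at most a 2^{-R} fraction of the coefficient vectors, where
-- R = ∑ C(d_b, 3) and d_b is the number of pivots in block b.  If D = B e is the
-- dimension, convexity gives R ≥ B C(e, 3), and with e = 3⌊√n⌋ this exceeds
-- n (D + 1), which bounds the logarithm of the number of flats.  Hence some f works
-- for every flat of dimension D = 3 B ⌊√n⌋ < 6.12 n^{2-s/2}.  The real number s
-- enters only through rational approximations, whose error the constant absorbs.

module Submission where

open import Defs
open import Algebra.Bundles using (CommutativeRing)
import Algebra.Properties.CommutativeSemigroup as CommutativeSemigroup
open import Data.Bool.Base using (Bool; true; false; _∧_; _∨_; _xor_; if_then_else_)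
open import Data.Bool.Properties
  using (xor-assoc; xor-identityʳ; xor-same; xor-∧-commutativeRing; ∧-zeroʳ; ∧-identityʳ;
         ∧-distribˡ-xor; ∧-distribʳ-xor; ∧-conicalˡ; ∧-conicalʳ; ¬-not; T?; T-≡)
  renaming (_≟_ to _≟ᵇ_)
open import Data.Empty using (⊥; ⊥-elim)
open import Data.Fin.Base using (Fin; zero; suc; _↑ˡ_; _↑ʳ_)
open import Data.Fin.Properties using () renaming (_≟_ to _≟ᶠ_)
open import Data.Fin.Subset using (Subset; ∣_∣)
open import Data.Integer.Base as ℤ using (+_; -[1+_])
import Data.Integer.Properties as ℤ
open import Data.List.Base as List using (List; filterᵇ; length; _++_)
open import Data.List.Extrema.Nat using (max≤v⁺; v≤max⁺)
open import Data.List.Membership.Propositional using (_∈_; lose)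
open import Data.List.Membership.Propositional.Properties
  using (∈-map⁺; ∈-++⁺ˡ; ∈-++⁺ʳ; ∈-filter⁺; ∈-filter⁻)
import Data.List.Properties as List
import Data.List.Relation.Unary.All as All
import Data.List.Relation.Unary.All.Properties as All
open import Data.List.Relation.Unary.Any using (here)
open import Data.Nat.Base as ℕ hiding (_/_)
open import Data.Nat.Combinatorics using (_C_; nCn≡1; nC1≡n; nCk≡nC[n∸k]; nCk+nC[k+1]≡[n+1]C[k+1])
open import Data.Nat.DivMod using (m/n*n≤m; m%n<n; m≡m%n+[m/n]*n; m<n⇒m/n≡0; /-monoˡ-≤)
open import Data.Nat.Properties
open import Data.Nat.Tactic.RingSolver using (solve-∀)
open import Data.Product.Base using (Σ; ∃; ∃-syntax; _×_; _,_; proj₁; proj₂)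
open import Data.Rational.Base as ℚ using (ℚ; mkℚ; ½; _/_; ↥_; ↧ₙ_; toℚᵘ)
import Data.Rational.Properties as ℚ
open import Data.Rational.Unnormalised.Base as ℚᵘ using (mkℚᵘ; *≡*; *<*)
import Data.Rational.Unnormalised.Properties as ℚᵘ
open import Data.Sum.Base using (inj₁; inj₂)
open import Data.Vec.Base as Vec using (Vec; []; _∷_; lookup; _[_]≔_; replicate; map)
open import Data.Vec.Properties
  using (≡-dec; zipWith-assoc; zipWith-identityˡ; zipWith-identityʳ; map-id; map-const; ∷-injectiveʳ;
         lookup-zipWith; lookup-replicate; lookup-++ˡ; lookup-++ʳ; lookup∘update′)
open import Function.Base using (_∘_)
open import Function.Bundles using (module Equivalence)
open import Function.Definitions using (Bijective)
open import Level using (0ℓ)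
open import Relation.Binary.PropositionalEquality
open import Relation.Nullary.Decidable
  using (Dec; yes; no; does; ¬?; map′; _×-dec_; _⊎-dec_; _→-dec_; decidable-stable; dec-false)
open import Relation.Nullary.Negation using (¬_)
open import Relation.Unary using (Pred; Decidable)

open CommutativeSemigroup +-commutativeSemigroup using (interchange)
open CommutativeSemigroup (CommutativeRing.+-commutativeSemigroup xor-∧-commutativeRing)
  using () renaming (interchange to xor-interchange)

-- Linear algebra over 𝔽₂

-- The constant is 6 · (102/101) · (101/100). With e = c√n the leading terms demand c² > 6, and 3 is
-- the least integer c that satisfies this. It doubles to 6 because B counts a last, partial block:
-- B m is only bounded by n + m, which comes close to 2n when m is close to n. The factor 102/101
-- pays for rounding m down, as m ≥ 101. The factor 101/100 pays for the approximation of s with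
-- denominator d, which lowers the exponent by up to 3/2d; d grows with n so that n^(3/2d) ≤ 1.01.
--
-- For fixed n everything is finite, so each case distinction is settled by exhaustive search, and
-- probabilities become counts of Boolean vectors. Densities appear as products with powers of 2,
-- roots as inequalities between integer powers. The union bound ranges over tuples of a shift and D
-- vectors, which are easier to enumerate than flats.

Exhaustible : Set → Set₁
Exhaustible A = ∀ {P : Pred A 0ℓ} → Decidable P → Dec (∃ P)

anyBool? : Exhaustible Bool
anyBool? P? = map′ (λ { (inj₁ p) → _ , p ; (inj₂ p) → _ , p })
  (λ { (true , p) → inj₁ p ; (false , p) → inj₂ p }) (P? true ⊎-dec P? false)

anyVec? : ∀ {A} → Exhaustible A → ∀ n → Exhaustible (Vec A n)
anyVec? any zero P? = map′ ([] ,_) (λ { ([] , p) → p }) (P? [])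
anyVec? any (suc n) P? = map′ (λ { (_ , _ , p) → _ , p }) (λ { (x ∷ xs , p) → x , xs , p })
  (any λ x → anyVec? any n λ xs → P? (x ∷ xs))

all? : ∀ {A} → Exhaustible A → {P : Pred A 0ℓ} → Decidable P → Dec (∀ x → P x)
all? any P? = map′ (λ ¬∃ x → decidable-stable (P? x) λ ¬p → ¬∃ (x , ¬p))
  (λ ∀p (x , ¬p) → ¬p (∀p x)) (¬? (any (¬? ∘ P?)))

any𝔽₂? : ∀ n → Exhaustible (𝔽₂^ n)
any𝔽₂? = anyVec? anyBool?

infix 4 _≟ᵛ_
_≟ᵛ_ : ∀ {n} (x y : 𝔽₂^ n) → Dec (x ≡ y)
_≟ᵛ_ = ≡-dec _≟ᵇ_

⊕-identityˡ : ∀ {n} (x : 𝔽₂^ n) → 𝟎 ⊕ x ≡ x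
⊕-identityˡ = zipWith-identityˡ λ _ → refl

⊕-identityʳ : ∀ {n} (x : 𝔽₂^ n) → x ⊕ 𝟎 ≡ x
⊕-identityʳ = zipWith-identityʳ xor-identityʳ

true-∙ : ∀ {n} (v : 𝔽₂^ n) → true ∙ v ≡ v
true-∙ = map-id

false-∙ : ∀ {n} (v : 𝔽₂^ n) → false ∙ v ≡ 𝟎
false-∙ v = map-const v false

∙-distribʳ-⊕ : ∀ {n} a b (v : 𝔽₂^ n) → (a xor b) ∙ v ≡ a ∙ v ⊕ b ∙ v
∙-distribʳ-⊕ a b []      = refl
∙-distribʳ-⊕ a b (x ∷ v) = cong₂ _∷_ (∧-distribʳ-xor x a b) (∙-distribʳ-⊕ a b v)

⊕-interchange : ∀ {n} (w x y z : 𝔽₂^ n) → (w ⊕ x) ⊕ (y ⊕ z) ≡ (w ⊕ y) ⊕ (x ⊕ z)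
⊕-interchange []      []      []      []      = refl
⊕-interchange (a ∷ w) (b ∷ x) (c ∷ y) (d ∷ z) =
  cong₂ _∷_ (xor-interchange a b c d) (⊕-interchange w x y z)

combination-⊕ : ∀ {k n} c d (vs : Vec (𝔽₂^ n) k) →
                combination (c ⊕ d) vs ≡ combination c vs ⊕ combination d vs
combination-⊕ []      []      []       = sym (⊕-identityˡ 𝟎)
combination-⊕ (a ∷ c) (b ∷ d) (v ∷ vs) =
  trans (cong₂ _⊕_ (∙-distribʳ-⊕ a b v) (combination-⊕ c d vs)) (⊕-interchange _ _ _ _)

combination-false : ∀ {k n} c (v : 𝔽₂^ n) (vs : Vec (𝔽₂^ n) k) →
                    combination (false ∷ c) (v ∷ vs) ≡ combination c vs
combination-false c v vs =
  trans (cong (_⊕ combination c vs) (false-∙ v)) (⊕-identityˡ _)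

combination-true : ∀ {k n} c (v : 𝔽₂^ n) (vs : Vec (𝔽₂^ n) k) →
                   combination (true ∷ c) (v ∷ vs) ≡ v ⊕ combination c vs
combination-true c v vs = cong (_⊕ combination c vs) (true-∙ v)

independent-tail : ∀ {k n} {v : 𝔽₂^ n} {vs : Vec (𝔽₂^ n) k} →
                   LinearlyIndependent (v ∷ vs) → LinearlyIndependent vs
independent-tail {v = v} {vs} li c eq =
  cong Vec.tail (li (false ∷ c) (trans (combination-false c v vs) eq))

-- The theorem concerns every large dimension while the counting is done for one dimension only. A
-- larger flat contains flats of that dimension, spanned by part of its basis.
independent-subfamily : ∀ {j k n} → j ≤ k → (vs : Vec (𝔽₂^ n) k) → LinearlyIndependent vs →
  Σ (Vec (𝔽₂^ n) j) λ ws → LinearlyIndependent ws ×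
    (∀ c → ∃[ d ] combination c ws ≡ combination d vs)
independent-subfamily {j} {k} j≤k vs li with m≤n⇒m<n∨m≡n j≤k
... | inj₂ refl = vs , li , λ c → c , refl
independent-subfamily {k = suc k} j≤k (v ∷ vs) li | inj₁ j<k
  with independent-subfamily (s≤s⁻¹ j<k) vs (independent-tail li)
... | ws , li′ , span = ws , li′ , λ c → false ∷ proj₁ (span c) ,
  trans (proj₂ (span c)) (sym (combination-false (proj₁ (span c)) v vs))

nonzero⇒∃true : ∀ {n} (x : 𝔽₂^ n) → x ≢ 𝟎 → ∃[ i ] lookup x i ≡ true
nonzero⇒∃true []          x≢𝟎 = ⊥-elim (x≢𝟎 refl)
nonzero⇒∃true (true ∷ x)  x≢𝟎 = zero , refl
nonzero⇒∃true (false ∷ x) x≢𝟎 with nonzero⇒∃true x (x≢𝟎 ∘ cong (false ∷_))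
... | i , eq = suc i , eq

AgreeOn : ∀ {n} → Subset n → 𝔽₂^ n → 𝔽₂^ n → Set
AgreeOn P x y = ∀ i → lookup P i ≡ true → lookup x i ≡ lookup y i

∣∣-insert : ∀ {n} (P : Subset n) i → lookup P i ≡ false → ∣ P [ i ]≔ true ∣ ≡ suc ∣ P ∣
∣∣-insert (false ∷ P) zero    eq = refl
∣∣-insert (false ∷ P) (suc i) eq = ∣∣-insert P i eq
∣∣-insert (true ∷ P)  (suc i) eq = cong suc (∣∣-insert P i eq)

∣𝟎∣ : ∀ n → ∣ 𝟎 {n} ∣ ≡ 0
∣𝟎∣ zero    = refl
∣𝟎∣ (suc n) = ∣𝟎∣ n

lookup-⊕ : ∀ {n} i (x y : 𝔽₂^ n) → lookup (x ⊕ y) i ≡ lookup x i xor lookup y i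
lookup-⊕ i x y = lookup-zipWith _xor_ i x y

-- Gaussian elimination: w is v reduced by vs so as to vanish on the old
-- pivots, and any coordinate at which w is nonzero is a new pivot.
pivots : ∀ {n k} (vs : Vec (𝔽₂^ n) k) → LinearlyIndependent vs →
         Σ (Subset n) λ P → ∣ P ∣ ≡ k × (∀ y → ∃[ c ] AgreeOn P (combination c vs) y)
pivots {n} [] li = 𝟎 , ∣𝟎∣ n ,
  λ y → [] , λ i eq → ⊥-elim (false≢true (trans (sym (lookup-replicate i false)) eq))
  where
  false≢true : false ≢ true
  false≢true ()
pivots {n} {suc k} (v ∷ vs) li with pivots vs (independent-tail li)
... | P , ∣P∣≡k , span = P [ q ]≔ true , trans (∣∣-insert P q Pq≡false) (cong suc ∣P∣≡k) , span′
  where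
  c₀ : 𝔽₂^ k
  c₀ = proj₁ (span v)
  w : 𝔽₂^ n
  w = v ⊕ combination c₀ vs
  w≢𝟎 : w ≢ 𝟎
  w≢𝟎 eq with li (true ∷ c₀) (trans (combination-true c₀ v vs) eq)
  ... | ()
  q : Fin n
  q = proj₁ (nonzero⇒∃true w w≢𝟎)
  wq≡true : lookup w q ≡ true
  wq≡true = proj₂ (nonzero⇒∃true w w≢𝟎)
  w-off : ∀ i → lookup P i ≡ true → lookup w i ≡ false
  w-off i eq = trans (lookup-⊕ i v _)
    (trans (cong (lookup v i xor_) (proj₂ (span v) i eq)) (xor-same (lookup v i)))
  Pq≡false : lookup P q ≡ false
  Pq≡false with lookup P q in eq
  ... | false = refl
  ... | true  = trans (sym wq≡true) (w-off q eq)
  extend : ∀ x y → AgreeOn P x y → lookup x q ≡ lookup y q → AgreeOn (P [ q ]≔ true) x y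
  extend x y agree agree-q i eq with i ≟ᶠ q
  ... | yes refl = agree-q
  ... | no  i≢q  = agree i (trans (sym (lookup∘update′ i≢q P true)) eq)
  xor-lemma : ∀ a b → a ≢ b → true xor a ≡ b
  xor-lemma false false a≢b = ⊥-elim (a≢b refl)
  xor-lemma false true  a≢b = refl
  xor-lemma true  false a≢b = refl
  xor-lemma true  true  a≢b = ⊥-elim (a≢b refl)
  span′ : ∀ y → ∃[ c ] AgreeOn (P [ q ]≔ true) (combination c (v ∷ vs)) y
  span′ y with span y
  ... | c , agree with lookup (combination c vs) q ≟ᵇ lookup y q
  ...   | yes eq = false ∷ c , subst (λ z → AgreeOn (P [ q ]≔ true) z y)
                     (sym (combination-false c v vs)) (extend (combination c vs) y agree eq)
  -- Adding `w` flips the coordinate `q` and preserves the agreement on the old pivots, where `w`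
  -- vanishes.
  ...   | no neq = true ∷ (c₀ ⊕ c) , subst (λ z → AgreeOn (P [ q ]≔ true) z y)
                     (sym flipped) (extend (w ⊕ combination c vs) y agree′ (trans (lookup-⊕ q w (combination c vs))
                       (trans (cong (_xor lookup (combination c vs) q) wq≡true) (xor-lemma _ _ neq))))
    where
    flipped : combination (true ∷ (c₀ ⊕ c)) (v ∷ vs) ≡ w ⊕ combination c vs
    flipped = trans (combination-true (c₀ ⊕ c) v vs) (trans (cong (v ⊕_) (combination-⊕ c₀ c vs))
      (sym (zipWith-assoc xor-assoc v (combination c₀ vs) (combination c vs))))
    agree′ : AgreeOn P (w ⊕ combination c vs) y
    agree′ i eq = trans (lookup-⊕ i w (combination c vs))
      (trans (cong (_xor lookup (combination c vs) i) (w-off i eq)) (agree i eq))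

-- Thickness is attained

least : ∀ {P : Pred ℕ 0ℓ} → Decidable P → ∀ t → P t → ∃[ m ] m ≤ t × P m × (∀ j → P j → m ≤ j)
least P? t pt with P? 0
... | yes p0 = 0 , z≤n , p0 , λ _ _ → z≤n
least P? zero pt | no ¬p0 = ⊥-elim (¬p0 pt)
least {P} P? (suc t) pt | no ¬p0 with least (P? ∘ suc) t pt
... | m , m≤t , pm , min = suc m , s≤s m≤t , pm , min′
  where
  min′ : ∀ j → P j → suc m ≤ j
  min′ zero    p = ⊥-elim (¬p0 p)
  min′ (suc j) p = s≤s (min j p)

identity : ∀ n → Vec (𝔽₂^ n) n
identity zero    = []
identity (suc n) = (true ∷ 𝟎) ∷ map (false ∷_) (identity n)

dot-𝟎 : ∀ {n} (x : 𝔽₂^ n) → dot 𝟎 x ≡ false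
dot-𝟎 []      = refl
dot-𝟎 (b ∷ x) = dot-𝟎 x

map-identity : ∀ {n} (x : 𝔽₂^ n) → map (λ row → dot row x) (identity n) ≡ x
map-identity []      = refl
map-identity (b ∷ x) = cong₂ _∷_ (trans (cong (b xor_) (dot-𝟎 x)) (xor-identityʳ b))
  (trans (tail (identity _)) (map-identity x))
  where
  tail : ∀ {k} (rows : Vec _ k) →
         map (λ row → dot row (b ∷ x)) (map (false ∷_) rows) ≡ map (λ row → dot row x) rows
  tail []           = refl
  tail (row ∷ rows) = cong (dot row x ∷_) (tail rows)

affine : ∀ {n} → Vec (𝔽₂^ n) n → 𝔽₂^ n → 𝔽₂^ n → 𝔽₂^ n
affine M v x = map (λ row → dot row x) M ⊕ v

affine-identity : ∀ {n} (x : 𝔽₂^ n) → affine (identity n) 𝟎 x ≡ x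
affine-identity x = trans (⊕-identityʳ _) (map-identity x)

bijective? : ∀ {n} (g : 𝔽₂^ n → 𝔽₂^ n) → Dec (Bijective _≡_ _≡_ g)
bijective? {n} g = map′
  (λ (inj , surj) → (λ {x} {y} → inj x y) ,
    λ y → proj₁ (surj y) , λ eq → trans (cong g eq) (proj₂ (surj y)))
  (λ (inj , surj) → (λ x y → inj {x} {y}) , λ y → proj₁ (surj y) , proj₂ (surj y) refl)
  (all? (any𝔽₂? n) (λ x → all? (any𝔽₂? n) λ y → (g x ≟ᵛ g y) →-dec (x ≟ᵛ y))
   ×-dec all? (any𝔽₂? n) λ y → any𝔽₂? n λ x → g x ≟ᵛ y)

identityBijection : ∀ n → AffineBijection n
identityBijection n = record
  { matrix = identity n ; shift = 𝟎
  ; bijective = (λ {x} {y} eq → trans (sym (affine-identity x)) (trans eq (affine-identity y)))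
              , λ y → y , λ {z} eq → trans (affine-identity z) eq }

-- An `AffineBijection` carries a proof, so the search runs over matrices and shifts, and
-- bijectivity is decided for each pair.
attains? : ∀ {n} (f : 𝔽₂^ n → 𝔽₂) (t : ℕ) →
           Dec (∃[ A ] sparsity (f ∘ apply {n} A) ≡ t)
attains? {n} f t = map′
  (λ { (M , v , bij , eq) → record { matrix = M ; shift = v ; bijective = bij } , eq })
  (λ (A , eq) → AffineBijection.matrix A , AffineBijection.shift A , AffineBijection.bijective A , eq)
  (anyVec? (any𝔽₂? n) n λ M → any𝔽₂? n λ v →
    bijective? (affine M v) ×-dec (sparsity (f ∘ affine M v) ≟ t))

thickness-exists : ∀ {n} (f : 𝔽₂^ n → 𝔽₂) →
  ∃[ t ] IsThickness f t × t ≤ sparsity (f ∘ apply (identityBijection n))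
thickness-exists f with least (attains? f) _ (identityBijection _ , refl)
... | t , t≤ , attained , minimal = t , (attained , λ A → minimal _ (A , refl)) , t≤

-- Counting subsets of the cube

count : ∀ {n} → (Vec Bool n → Bool) → ℕ
count {zero}  p = if p [] then 1 else 0
count {suc n} p = count (p ∘ (false ∷_)) + count (p ∘ (true ∷_))

count-mono : ∀ {n} (p q : Vec Bool n → Bool) → (∀ x → p x ≡ true → q x ≡ true) → count p ≤ count q
count-mono {zero} p q p⊆q with p [] | q [] | p⊆q []
... | false | _     | _ = z≤n
... | true  | true  | _ = ≤-refl
... | true  | false | h with h refl
...   | ()
count-mono {suc n} p q p⊆q =
  +-mono-≤ (count-mono _ _ (p⊆q ∘ (false ∷_))) (count-mono _ _ (p⊆q ∘ (true ∷_)))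

count-cong : ∀ {n} (p q : Vec Bool n → Bool) → (∀ x → p x ≡ q x) → count p ≡ count q
count-cong {zero}  p q eq rewrite eq [] = refl
count-cong {suc n} p q eq =
  cong₂ _+_ (count-cong _ _ (eq ∘ (false ∷_))) (count-cong _ _ (eq ∘ (true ∷_)))

count-false : ∀ n → count {n} (λ _ → false) ≡ 0
count-false zero    = refl
count-false (suc n) = cong₂ _+_ (count-false n) (count-false n)

2^suc : ∀ n → 2 ^ n + 2 ^ n ≡ 2 ^ suc n
2^suc n = cong (_+_ (2 ^ n)) (sym (+-identityʳ (2 ^ n)))

count-true : ∀ n → count {n} (λ _ → true) ≡ 2 ^ n
count-true zero    = refl
count-true (suc n) = trans (cong₂ _+_ (count-true n) (count-true n)) (2^suc n)

count-∨ : ∀ {n} (p q : Vec Bool n → Bool) → count (λ x → p x ∨ q x) ≤ count p + count q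
count-∨ {zero} p q with p [] | q []
... | false | _     = ≤-refl
... | true  | false = ≤-refl
... | true  | true  = s≤s z≤n
count-∨ {suc n} p q = begin
  count (λ x → p (false ∷ x) ∨ q (false ∷ x)) + count (λ x → p (true ∷ x) ∨ q (true ∷ x))
    ≤⟨ +-mono-≤ (count-∨ (p ∘ (false ∷_)) _) (count-∨ (p ∘ (true ∷_)) _) ⟩
  (count (p ∘ (false ∷_)) + count (q ∘ (false ∷_))) + (count (p ∘ (true ∷_)) + count (q ∘ (true ∷_)))
    ≡⟨ interchange (count (p ∘ (false ∷_))) _ _ _ ⟩
  count p + count q ∎
  where open ≤-Reasoning

count-disjoint : ∀ {n} (p q : Vec Bool n → Bool) → (∀ x → p x ≡ true → q x ≡ true → ⊥) →
                 count p + count q ≡ count (λ x → p x ∨ q x)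
count-disjoint {zero} p q disj with p [] | q [] | disj []
... | false | _     | _ = refl
... | true  | false | _ = refl
... | true  | true  | h = ⊥-elim (h refl refl)
count-disjoint {suc n} p q disj = trans (interchange (count (p ∘ (false ∷_))) _ _ _)
  (cong₂ _+_ (count-disjoint _ _ (disj ∘ (false ∷_))) (count-disjoint _ _ (disj ∘ (true ∷_))))

AgreeOff : ∀ {n} → Subset n → Vec Bool n → Vec Bool n → Set
AgreeOff Q x y = ∀ i → lookup Q i ≡ false → lookup x i ≡ lookup y i

agreeOff-∷ : ∀ {n b a} {Q : Subset n} {x y} → AgreeOff Q x y → AgreeOff (b ∷ Q) (a ∷ x) (a ∷ y)
agreeOff-∷ agree zero    eq = refl
agreeOff-∷ agree (suc i) eq = agree i eq

agreeOff-true∷ : ∀ {n a b} {Q : Subset n} {x y} → AgreeOff Q x y → AgreeOff (true ∷ Q) (a ∷ x) (b ∷ y)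
agreeOff-true∷ agree (suc i) eq = agree i eq

-- Deleting the coordinates in `Q` is injective on the points of `p`. At such a coordinate the two
-- halves of `p` stay disjoint after deletion and merge into `either`, which saves a factor 2.
count-determined : ∀ {n} (Q : Subset n) (p : Vec Bool n → Bool) →
  (∀ x y → p x ≡ true → p y ≡ true → AgreeOff Q x y → x ≡ y) → count p * 2 ^ ∣ Q ∣ ≤ 2 ^ n
count-determined [] p det with p []
... | false = z≤n
... | true  = ≤-refl
count-determined {suc n} (false ∷ Q) p det = begin
  (count (p ∘ (false ∷_)) + count (p ∘ (true ∷_))) * 2 ^ ∣ Q ∣ ≡⟨ *-distribʳ-+ (2 ^ ∣ Q ∣) (count (p ∘ (false ∷_))) _ ⟩
  count (p ∘ (false ∷_)) * 2 ^ ∣ Q ∣ + count (p ∘ (true ∷_)) * 2 ^ ∣ Q ∣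
    ≤⟨ +-mono-≤ (half false) (half true) ⟩
  2 ^ n + 2 ^ n ≡⟨ 2^suc n ⟩
  2 ^ suc n ∎
  where
  open ≤-Reasoning
  half : ∀ b → count (p ∘ (b ∷_)) * 2 ^ ∣ Q ∣ ≤ 2 ^ n
  half b = count-determined Q (p ∘ (b ∷_)) λ x y px py agree →
    ∷-injectiveʳ (det (b ∷ x) (b ∷ y) px py (agreeOff-∷ agree))
count-determined {suc n} (true ∷ Q) p det = begin
  (count (p ∘ (false ∷_)) + count (p ∘ (true ∷_))) * (2 * 2 ^ ∣ Q ∣)
    ≡⟨ cong (_* (2 * 2 ^ ∣ Q ∣)) (count-disjoint (p ∘ (false ∷_)) (p ∘ (true ∷_)) disjoint) ⟩
  count either * (2 * 2 ^ ∣ Q ∣) ≡⟨ lemma (count either) (2 ^ ∣ Q ∣) ⟩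
  2 * (count either * 2 ^ ∣ Q ∣) ≤⟨ *-monoʳ-≤ 2 (count-determined Q either det′) ⟩
  2 ^ suc n ∎
  where
  open ≤-Reasoning
  lemma : ∀ a b → a * (2 * b) ≡ 2 * (a * b)
  lemma = solve-∀
  either : Vec Bool n → Bool
  either x = p (false ∷ x) ∨ p (true ∷ x)
  disjoint : ∀ x → p (false ∷ x) ≡ true → p (true ∷ x) ≡ true → ⊥
  disjoint x pf pt with det _ _ pf pt (agreeOff-true∷ λ _ _ → refl)
  ... | ()
  witness : ∀ x → either x ≡ true → ∃[ b ] p (b ∷ x) ≡ true
  witness x eq with p (false ∷ x) in eqf
  ... | true  = false , eqf
  ... | false = true , eq
  det′ : ∀ x y → either x ≡ true → either y ≡ true → AgreeOff Q x y → x ≡ y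
  det′ x y ex ey agree with witness x ex | witness y ey
  ... | a , px | b , py = ∷-injectiveʳ (det (a ∷ x) (b ∷ y) px py (agreeOff-true∷ agree))

count<⇒∃false : ∀ {n} (p : Vec Bool n → Bool) → count p < 2 ^ n → ∃[ x ] p x ≡ false
count<⇒∃false {n} p small with any𝔽₂? n (λ x → p x ≟ᵇ false)
... | yes found = found
... | no  none  = ⊥-elim (<⇒≢ small (trans (count-cong p (λ _ → true) all-true) (count-true n)))
  where
  all-true : ∀ x → p x ≡ true
  all-true x with p x in eq
  ... | true  = refl
  ... | false = ⊥-elim (none (x , eq))

-- A has at most N elements, as far as union bounds over A are concerned.
UnionBound : Set → ℕ → Set
UnionBound A N = ∀ {n y z} (p : A → Vec Bool n → Bool) → (∀ a → count (p a) * z ≤ y) →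
  Σ (Vec Bool n → Bool) λ q → count q * z ≤ N * y × (∀ a x → p a x ≡ true → q x ≡ true)

∨-true-left : ∀ {a} b → a ≡ true → a ∨ b ≡ true
∨-true-left b refl = refl

∨-true-right : ∀ a {b} → b ≡ true → a ∨ b ≡ true
∨-true-right false refl = refl
∨-true-right true  refl = refl

unionBound-Bool : UnionBound Bool 2
unionBound-Bool {y = y} {z} p bound = q , count-q ,
    λ { false x eq → ∨-true-left (p true x) eq ; true x eq → ∨-true-right (p false x) eq }
  where
  q = λ x → p false x ∨ p true x
  count-q : count q * z ≤ 2 * y
  count-q = begin
    count q * z                                ≤⟨ *-monoˡ-≤ z (count-∨ (p false) (p true)) ⟩
    (count (p false) + count (p true)) * z     ≡⟨ *-distribʳ-+ z (count (p false)) (count (p true)) ⟩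
    count (p false) * z + count (p true) * z   ≤⟨ +-mono-≤ (bound false) (bound true) ⟩
    y + y                                      ≡⟨ cong (_+_ y) (+-identityʳ y) ⟨
    2 * y                                      ∎
    where open ≤-Reasoning

-- For each head a single predicate covers all tails; the union bound for `A` then covers these
-- predicates, so the cardinalities multiply.
unionBound-Vec : ∀ {A N} → UnionBound A N → ∀ k → UnionBound (Vec A k) (N ^ k)
unionBound-Vec ub zero {y = y} p bound =
  p [] , ≤-trans (bound []) (≤-reflexive (sym (+-identityʳ y))) , λ { [] x eq → eq }
unionBound-Vec {N = N} ub (suc k) {y = y} p bound with
  ub (λ a → proj₁ (unionBound-Vec ub k (λ as → p (a ∷ as)) (λ as → bound (a ∷ as))))
     (λ a → proj₁ (proj₂ (unionBound-Vec ub k (λ as → p (a ∷ as)) (λ as → bound (a ∷ as)))))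
... | q , count-q , covers = q , ≤-trans count-q (≤-reflexive (sym (*-assoc N (N ^ k) y))) ,
  λ { (a ∷ as) x eq → covers a x
        (proj₂ (proj₂ (unionBound-Vec ub k (λ as → p (a ∷ as)) (λ as → bound (a ∷ as)))) as x eq) }

2^-cancel-≤ : ∀ {m n} → 2 ^ m ≤ 2 ^ n → m ≤ n
2^-cancel-≤ {m} {n} le = ≮⇒≥ λ n<m → <⇒≱ (^-monoʳ-< 2 (s≤s (s≤s z≤n)) n<m) le

-- The first-moment method: 2^K sets of density at most 2^(-r) cannot cover the cube when K < r.
avoid : ∀ {A K} → UnionBound A (2 ^ K) → ∀ {n r} (p : A → Vec Bool n → Bool) →
        (∀ a → count (p a) * 2 ^ r ≤ 2 ^ n) → K < r →
        ∃[ x ] ∀ a → p a x ≡ false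
avoid {K = K} ub {n} {r} p bound K<r with ub p bound
... | q , count-q , covers with count<⇒∃false q (≰⇒> too-big)
  where
  too-big : ¬ 2 ^ n ≤ count q
  too-big le = <⇒≱ K<r (2^-cancel-≤ (*-cancelˡ-≤ (2 ^ n) {{m^n≢0 2 n}} (begin
    2 ^ n * 2 ^ r   ≤⟨ *-monoˡ-≤ (2 ^ r) le ⟩
    count q * 2 ^ r ≤⟨ count-q ⟩
    2 ^ K * 2 ^ n   ≡⟨ *-comm (2 ^ K) (2 ^ n) ⟩
    2 ^ n * 2 ^ K   ∎)))
    where open ≤-Reasoning
... | x , qx = x , λ a → ¬-not λ eq → true≢false (trans (sym (covers a x eq)) qx)
  where
  true≢false : true ≢ false
  true≢false ()

sparsity≡count : ∀ {n} (f : 𝔽₂^ n → 𝔽₂) → sparsity f ≡ count (anf f)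
sparsity≡count f = go (anf f)
  where
  filter-map : ∀ {A B : Set} (g : A → B) (p : B → Bool) xs →
               length (filterᵇ p (List.map g xs)) ≡ length (filterᵇ (p ∘ g) xs)
  filter-map g p List.[] = refl
  filter-map g p (x List.∷ xs) with p (g x)
  ... | true  = cong suc (filter-map g p xs)
  ... | false = filter-map g p xs
  go : ∀ {n} (p : Subset n → Bool) → length (filterᵇ p (subsets n)) ≡ count p
  go {zero} p with p []
  ... | true  = refl
  ... | false = refl
  go {suc n} p = begin
    length (filterᵇ p (List.map (false ∷_) (subsets n) ++ List.map (true ∷_) (subsets n)))
      ≡⟨ cong length (List.filter-++ (T? ∘ p) (List.map (false ∷_) (subsets n)) _) ⟩
    length (filterᵇ p (List.map (false ∷_) (subsets n)) ++ filterᵇ p (List.map (true ∷_) (subsets n)))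
      ≡⟨ List.length-++ (filterᵇ p (List.map (false ∷_) (subsets n))) ⟩
    length (filterᵇ p (List.map (false ∷_) (subsets n))) + length (filterᵇ p (List.map (true ∷_) (subsets n)))
      ≡⟨ cong₂ _+_ (trans (filter-map (false ∷_) p (subsets n)) (go (p ∘ (false ∷_))))
                   (trans (filter-map (true ∷_) p (subsets n)) (go (p ∘ (true ∷_)))) ⟩
    count p ∎
    where open ≡-Reasoning

-- This is 2^n, written as a sum so that a coefficient vector splits by `_++_` according to the
-- first variable; `2 ^ suc n` would unfold with a trailing `+ 0`.
size : ℕ → ℕ
size zero    = 1
size (suc n) = size n + size n

index : ∀ {n} → Subset n → Fin (size n)
index []                  = zero
index {suc n} (false ∷ S) = index S ↑ˡ size n
index {suc n} (true ∷ S)  = size n ↑ʳ index S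

table : ∀ {n} → (Subset n → Bool) → Vec Bool (size n)
table {zero}  g = g [] ∷ []
table {suc n} g = table (g ∘ (false ∷_)) Vec.++ table (g ∘ (true ∷_))

lookup-table : ∀ {n} (g : Subset n → Bool) S → lookup (table g) (index S) ≡ g S
lookup-table g []          = refl
lookup-table g (false ∷ S) =
  trans (lookup-++ˡ (table (g ∘ (false ∷_))) _ (index S)) (lookup-table (g ∘ (false ∷_)) S)
lookup-table g (true ∷ S)  =
  trans (lookup-++ʳ (table (g ∘ (false ∷_))) _ (index S)) (lookup-table (g ∘ (true ∷_)) S)

lookup-index-ext : ∀ {n} (c d : Vec Bool (size n)) →
  (∀ S → lookup c (index S) ≡ lookup d (index {n} S)) → c ≡ d
lookup-index-ext {zero} (a ∷ []) (b ∷ []) eq = cong (_∷ []) (eq [])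
lookup-index-ext {suc n} c d eq with Vec.splitAt (size n) c | Vec.splitAt (size n) d
... | c₀ , c₁ , refl | d₀ , d₁ , refl = cong₂ Vec._++_
  (lookup-index-ext c₀ d₀ λ S → trans (sym (lookup-++ˡ c₀ c₁ (index S)))
    (trans (eq (false ∷ S)) (lookup-++ˡ d₀ d₁ (index S))))
  (lookup-index-ext c₁ d₁ λ S → trans (sym (lookup-++ʳ c₀ c₁ (index S)))
    (trans (eq (true ∷ S)) (lookup-++ʳ d₀ d₁ (index S))))

∣table∣ : ∀ {n} (g : Subset n → Bool) → ∣ table g ∣ ≡ count g
∣table∣ {zero} g with g []
... | true  = refl
... | false = refl
∣table∣ {suc n} g = trans (∣∣-++ (table (g ∘ (false ∷_))) _)
  (cong₂ _+_ (∣table∣ (g ∘ (false ∷_))) (∣table∣ (g ∘ (true ∷_))))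
  where
  ∣∣-++ : ∀ {m n} (P : Subset m) (Q : Subset n) → ∣ P Vec.++ Q ∣ ≡ ∣ P ∣ + ∣ Q ∣
  ∣∣-++ []          Q = refl
  ∣∣-++ (true ∷ P)  Q = cong suc (∣∣-++ P Q)
  ∣∣-++ (false ∷ P) Q = ∣∣-++ P Q

-- Polynomials and binomial sums

eval-zero : ∀ {n} (γ : Subset n → 𝔽₂) → (∀ S → γ S ≡ false) → ∀ x → eval γ x ≡ false
eval-zero γ zer []      rewrite zer [] = refl
eval-zero γ zer (b ∷ x) = trans (eval-∷ γ b x) (trans
  (cong₂ (λ u v → u xor (b ∧ v)) (eval-zero _ (zer ∘ (false ∷_)) x) (eval-zero _ (zer ∘ (true ∷_)) x))
  (∧-zeroʳ b))

eval-𝟎 : ∀ {n} (γ : Subset n → 𝔽₂) → eval γ 𝟎 ≡ γ 𝟎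
eval-𝟎 {zero}  γ = trans (xor-identityʳ _) (∧-identityʳ (γ []))
eval-𝟎 {suc n} γ = trans (eval-∷ γ false 𝟎) (trans (xor-identityʳ _) (eval-𝟎 (γ ∘ (false ∷_))))

eval-xor : ∀ {n} (γ δ : Subset n → 𝔽₂) x → eval (λ S → γ S xor δ S) x ≡ eval γ x xor eval δ x
eval-xor γ δ [] with γ [] | δ []
... | false | false = refl
... | false | true  = refl
... | true  | false = refl
... | true  | true  = refl
eval-xor γ δ (b ∷ x) = begin
  eval (λ S → γ S xor δ S) (b ∷ x) ≡⟨ eval-∷ _ b x ⟩
  eval (λ S → γ₀ S xor δ₀ S) x xor (b ∧ eval (λ S → γ₁ S xor δ₁ S) x)
    ≡⟨ cong₂ (λ u v → u xor (b ∧ v)) (eval-xor γ₀ δ₀ x) (eval-xor γ₁ δ₁ x) ⟩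
  (eval γ₀ x xor eval δ₀ x) xor (b ∧ (eval γ₁ x xor eval δ₁ x))
    ≡⟨ cong ((eval γ₀ x xor eval δ₀ x) xor_) (∧-distribˡ-xor b (eval γ₁ x) _) ⟩
  (eval γ₀ x xor eval δ₀ x) xor ((b ∧ eval γ₁ x) xor (b ∧ eval δ₁ x))
    ≡⟨ xor-interchange (eval γ₀ x) _ _ _ ⟩
  (eval γ₀ x xor (b ∧ eval γ₁ x)) xor (eval δ₀ x xor (b ∧ eval δ₁ x))
    ≡⟨ cong₂ _xor_ (eval-∷ γ b x) (eval-∷ δ b x) ⟨
  eval γ (b ∷ x) xor eval δ (b ∷ x) ∎
  where
  open ≡-Reasoning
  γ₀ = γ ∘ (false ∷_)
  γ₁ = γ ∘ (true ∷_)
  δ₀ = δ ∘ (false ∷_)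
  δ₁ = δ ∘ (true ∷_)

infix 7 _⊆ᵇ_
_⊆ᵇ_ : ∀ {n} → Subset n → Subset n → Bool
[]          ⊆ᵇ []      = true
(false ∷ S) ⊆ᵇ (p ∷ P) = S ⊆ᵇ P
(true ∷ S)  ⊆ᵇ (p ∷ P) = p ∧ S ⊆ᵇ P

eval-agree : ∀ {n} (P : Subset n) (γ : Subset n → 𝔽₂) → (∀ S → S ⊆ᵇ P ≡ false → γ S ≡ false) →
             ∀ x y → AgreeOn P x y → eval γ x ≡ eval γ y
eval-agree [] γ supp [] [] agree = refl
eval-agree (p ∷ P) γ supp (a ∷ x) (b ∷ y) agree = trans (eval-∷ γ a x)
  (trans (cong₂ _xor_ (eval-agree P (γ ∘ (false ∷_)) (supp ∘ (false ∷_)) x y agree′) (tail p refl))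
         (sym (eval-∷ γ b y)))
  where
  agree′ : AgreeOn P x y
  agree′ i = agree (suc i)
  tail : ∀ q → q ≡ p → a ∧ eval (γ ∘ (true ∷_)) x ≡ b ∧ eval (γ ∘ (true ∷_)) y
  tail true  refl = cong₂ _∧_ (agree zero refl) (eval-agree P _ (supp ∘ (true ∷_)) x y agree′)
  tail false refl = trans (vanish a x) (sym (vanish b y))
    where
    vanish : ∀ c z → c ∧ eval (γ ∘ (true ∷_)) z ≡ false
    vanish c z = trans (cong (c ∧_) (eval-zero _ (λ S → supp (true ∷ S) refl) z)) (∧-zeroʳ c)

-- Both `γ` and the zero coefficients represent the zero function, so uniqueness of the algebraic
-- normal form identifies them.
eval-zero⇒zero : ∀ {n} (γ : Subset n → 𝔽₂) → (∀ x → eval γ x ≡ false) → ∀ S → γ S ≡ false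
eval-zero⇒zero γ zer S = trans (anf-unique (λ _ → false) γ zer S)
  (sym (anf-unique (λ _ → false) (λ _ → false) (eval-zero (λ _ → false) λ _ → refl) S))

Σ< : ℕ → (ℕ → ℕ) → ℕ
Σ< zero    f = 0
Σ< (suc B) f = f B + Σ< B f

Σ<-cong : ∀ B {f g} → (∀ b → b < B → f b ≡ g b) → Σ< B f ≡ Σ< B g
Σ<-cong zero    eq = refl
Σ<-cong (suc B) eq = cong₂ _+_ (eq B ≤-refl) (Σ<-cong B λ b b<B → eq b (m<n⇒m<1+n b<B))

Σ<-mono : ∀ B {f g} → (∀ b → f b ≤ g b) → Σ< B f ≤ Σ< B g
Σ<-mono zero    le = z≤n
Σ<-mono (suc B) le = +-mono-≤ (le B) (Σ<-mono B le)

Σ<-+ : ∀ B f g → Σ< B (λ b → f b + g b) ≡ Σ< B f + Σ< B g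
Σ<-+ zero    f g = refl
Σ<-+ (suc B) f g = trans (cong (_+_ (f B + g B)) (Σ<-+ B f g)) (interchange (f B) _ _ _)

Σ<-*ʳ : ∀ B f x → Σ< B (λ b → f b * x) ≡ Σ< B f * x
Σ<-*ʳ zero    f x = refl
Σ<-*ʳ (suc B) f x = trans (cong (_+_ (f B * x)) (Σ<-*ʳ B f x)) (sym (*-distribʳ-+ x (f B) _))

Σ<-const : ∀ B x → Σ< B (λ _ → x) ≡ B * x
Σ<-const zero    x = refl
Σ<-const (suc B) x = cong (_+_ x) (Σ<-const B x)

-- Used when a new pivot enters: it alters the summand of its own block and no other.
Σ<-update : ∀ {B b₀ x} (f g : ℕ → ℕ) → b₀ < B → g b₀ ≡ x + f b₀ →
            (∀ b → b ≢ b₀ → g b ≡ f b) → Σ< B g ≡ x + Σ< B f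
Σ<-update {suc B} {b₀} {x} f g b₀<B at off with m≤n⇒m<n∨m≡n (s≤s⁻¹ b₀<B)
... | inj₁ b₀<B′ = trans (cong₂ _+_ (off B (>⇒≢ b₀<B′)) (Σ<-update f g b₀<B′ at off))
                     (lemma (f B) x _)
  where
  lemma : ∀ a b c → a + (b + c) ≡ b + (a + c)
  lemma = solve-∀
... | inj₂ refl  = trans (cong₂ _+_ at (Σ<-cong B λ b b<B → off b (<⇒≢ b<B))) (+-assoc x _ _)

nC0≡1 : ∀ n → n C 0 ≡ 1
nC0≡1 n = trans (nCk≡nC[n∸k] {0} {n} z≤n) (nCn≡1 n)

pascal : ∀ n k → suc n C suc k ≡ n C k + n C suc k
pascal n k = sym (nCk+nC[k+1]≡[n+1]C[k+1] n k)

C-monoˡ : ∀ {m n} k → m ≤ n → m C k ≤ n C k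
C-monoˡ k m≤n = go k (≤⇒≤′ m≤n)
  where
  go : ∀ {m n} k → m ≤′ n → m C k ≤ n C k
  go k       ≤′-refl        = ≤-refl
  go {m} zero (≤′-step {n} le) = ≤-reflexive (trans (nC0≡1 m) (sym (nC0≡1 (suc n))))
  go {m} (suc k) (≤′-step {n} le) = begin
    m C suc k             ≤⟨ go (suc k) le ⟩
    n C suc k             ≤⟨ m≤n+m _ (n C k) ⟩
    n C k + n C suc k     ≡⟨ pascal n k ⟨
    suc n C suc k         ∎
    where open ≤-Reasoning

C2≤square : ∀ d → d C 2 ≤ d * d
C2≤square zero    = z≤n
C2≤square (suc d) = begin
  suc d C 2       ≡⟨ pascal d 1 ⟩
  d C 1 + d C 2   ≡⟨ cong (_+ d C 2) (nC1≡n d) ⟩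
  d + d C 2       ≤⟨ +-monoʳ-≤ d (C2≤square d) ⟩
  d + d * d       ≤⟨ m≤n+m _ (suc d) ⟩
  suc d + (d + d * d) ≡⟨ lemma d ⟩
  suc d * suc d   ∎
  where
  open ≤-Reasoning
  lemma : ∀ d → suc d + (d + d * d) ≡ suc d * suc d
  lemma = solve-∀

-- Convexity of d ↦ d C 3, written additively.
C3-tangent : ∀ d e → e C 3 + d * (e C 2) ≤ d C 3 + e * (e C 2)
C3-tangent d e with ≤-total e d
... | inj₁ e≤d = subst (λ d → e C 3 + d * (e C 2) ≤ d C 3 + e * (e C 2)) (m∸n+n≡m e≤d) (above (d ∸ e))
  where
  open ≤-Reasoning
  -- By Pascal's rule `d C 3` grows by `d C 2`, which is at least the slope `e C 2` from `e` upwards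
  -- and at most that slope below `e`.
  above : ∀ j → e C 3 + (j + e) * (e C 2) ≤ (j + e) C 3 + e * (e C 2)
  above zero    = ≤-refl
  above (suc j) = begin
    e C 3 + (e C 2 + (j + e) * (e C 2))         ≡⟨ lemma (e C 3) (e C 2) _ ⟩
    e C 2 + (e C 3 + (j + e) * (e C 2))         ≤⟨ +-mono-≤ (C-monoˡ 2 (m≤n+m e j)) (above j) ⟩
    (j + e) C 2 + ((j + e) C 3 + e * (e C 2))   ≡⟨ +-assoc ((j + e) C 2) _ _ ⟨
    (j + e) C 2 + (j + e) C 3 + e * (e C 2)     ≡⟨ cong (_+ e * (e C 2)) (pascal (j + e) 2) ⟨
    suc (j + e) C 3 + e * (e C 2)               ∎
    where
    lemma : ∀ a b c → a + (b + c) ≡ b + (a + c)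
    lemma = solve-∀
... | inj₂ d≤e = subst (λ e → e C 3 + d * (e C 2) ≤ d C 3 + e * (e C 2)) (m∸n+n≡m d≤e) shifted
  where
  open ≤-Reasoning
  below : ∀ j → (j + d) C 3 ≤ d C 3 + j * ((j + d) C 2)
  below zero    = ≤-reflexive (sym (+-identityʳ _))
  below (suc j) = begin
    suc (j + d) C 3                              ≡⟨ pascal (j + d) 2 ⟩
    (j + d) C 2 + (j + d) C 3                    ≤⟨ +-monoʳ-≤ _ (below j) ⟩
    (j + d) C 2 + (d C 3 + j * ((j + d) C 2))    ≡⟨ lemma ((j + d) C 2) (d C 3) j ⟩
    d C 3 + suc j * ((j + d) C 2)
      ≤⟨ +-monoʳ-≤ (d C 3) (*-monoʳ-≤ (suc j) (C-monoˡ 2 (n≤1+n (j + d)))) ⟩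
    d C 3 + suc j * (suc (j + d) C 2)            ∎
    where
    lemma : ∀ a b j → a + (b + j * a) ≡ b + (a + j * a)
    lemma = solve-∀
  shifted : (e ∸ d + d) C 3 + d * ((e ∸ d + d) C 2) ≤ d C 3 + (e ∸ d + d) * ((e ∸ d + d) C 2)
  shifted = begin
    (e ∸ d + d) C 3 + d * c           ≤⟨ +-monoˡ-≤ (d * c) (below (e ∸ d)) ⟩
    d C 3 + (e ∸ d) * c + d * c       ≡⟨ lemma (d C 3) (e ∸ d) d c ⟩
    d C 3 + (e ∸ d + d) * c           ∎
    where
    c = (e ∸ d + d) C 2
    lemma : ∀ a b c x → a + b * x + c * x ≡ a + (b + c) * x
    lemma = solve-∀

-- Jensen's inequality: when the tangent inequalities are summed over the blocks, the linear terms
-- cancel because `f` has average `e`.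
Σ<-C3-convex : ∀ B e f → Σ< B f ≡ B * e → B * (e C 3) ≤ Σ< B (λ b → f b C 3)
Σ<-C3-convex B e f total = +-cancelʳ-≤ (B * (e * (e C 2))) _ _ (begin
  B * (e C 3) + B * (e * (e C 2))                          ≡⟨ cong (_+_ (B * (e C 3))) (*-assoc B e (e C 2)) ⟨
  B * (e C 3) + B * e * (e C 2)                            ≡⟨ cong (λ t → B * (e C 3) + t * (e C 2)) total ⟨
  B * (e C 3) + Σ< B f * (e C 2)                           ≡⟨ cong₂ _+_ (Σ<-const B (e C 3)) (Σ<-*ʳ B f (e C 2)) ⟨
  Σ< B (λ _ → e C 3) + Σ< B (λ b → f b * (e C 2))          ≡⟨ Σ<-+ B (λ _ → e C 3) _ ⟨
  Σ< B (λ b → e C 3 + f b * (e C 2))                       ≤⟨ Σ<-mono B (λ b → C3-tangent (f b) e) ⟩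
  Σ< B (λ b → f b C 3 + e * (e C 2))                       ≡⟨ Σ<-+ B (λ b → f b C 3) _ ⟩
  Σ< B (λ b → f b C 3) + Σ< B (λ _ → e * (e C 2))          ≡⟨ cong (_+_ (Σ< B (λ b → f b C 3))) (Σ<-const B _) ⟩
  Σ< B (λ b → f b C 3) + B * (e * (e C 2))                 ∎)
  where open ≤-Reasoning

-- Random sums of cubic forms in disjoint blocks of variables

does-true : ∀ {A : Set} (A? : Dec A) → does A? ≡ true → A
does-true (yes a) _ = a

does-false : ∀ {A : Set} (A? : Dec A) → does A? ≡ false → ¬ A
does-false (no ¬a) _ = ¬a

full : ∀ n → Subset n
full n = replicate n true

⊆ᵇ-full : ∀ {n} (S : Subset n) → S ⊆ᵇ full n ≡ true
⊆ᵇ-full []          = refl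
⊆ᵇ-full (true ∷ S)  = ⊆ᵇ-full S
⊆ᵇ-full (false ∷ S) = ⊆ᵇ-full S

module Monochromatic (colour : ℕ → ℕ) where

  -- The head of a subset of [ suc n ] carries the position n, so that
  -- positions are stable under taking tails.
  mono : ℕ → ℕ → ∀ {n} → Subset n → Bool
  mono j       b []                  = j ≡ᵇ 0
  mono j       b (false ∷ S)         = mono j b S
  mono zero    b (true ∷ S)          = false
  mono (suc j) b {suc n} (true ∷ S)  = (colour n ≡ᵇ b) ∧ mono j b S

  -- The admissible monomials. The element with the largest position fixes the block that the other
  -- two must share.
  triple : ∀ {n} → Subset n → Bool
  triple []                 = false
  triple (false ∷ S)        = triple S
  triple {suc n} (true ∷ S) = mono 2 (colour n) S

  -- For a pivot set `P` this is the number d_b.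
  class : ℕ → ∀ {n} → Subset n → ℕ
  class b []                 = 0
  class b (false ∷ P)        = class b P
  class b {suc n} (true ∷ P) = (if colour n ≡ᵇ b then 1 else 0) + class b P

  mono-size : ∀ j b {n} (S : Subset n) → mono j b S ≡ true → ∣ S ∣ ≡ j
  mono-size zero    b []          eq = refl
  mono-size j       b (false ∷ S) eq = mono-size j b S eq
  mono-size (suc j) b {suc n} (true ∷ S) eq =
    cong suc (mono-size j b S (∧-conicalʳ (colour n ≡ᵇ b) _ eq))

  triple-size : ∀ {n} (S : Subset n) → triple S ≡ true → ∣ S ∣ ≡ 3
  triple-size (false ∷ S) eq = triple-size S eq
  triple-size (true ∷ S)  eq = cong suc (mono-size 2 _ S eq)

  triple-𝟎 : ∀ n → triple (𝟎 {n}) ≡ false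
  triple-𝟎 zero    = refl
  triple-𝟎 (suc n) = triple-𝟎 n

  -- Positions 0, 1 and 2 sit at the end of the vector, so one triple survives while the vector
  -- grows at the head. It provides a cubic monomial in the degenerate case of `good-form`.
  triple-exists : colour 1 ≡ colour 2 → colour 0 ≡ colour 2 → ∀ k → ∃[ S ] triple {k + 3} S ≡ true
  triple-exists eq₁ eq₀ zero    = full 3 , cong₂ _∧_ (eq⇒≡ᵇ eq₁) (cong (_∧ true) (eq⇒≡ᵇ eq₀))
    where
    eq⇒≡ᵇ : ∀ {a b} → a ≡ b → (a ≡ᵇ b) ≡ true
    eq⇒≡ᵇ {a} {b} eq = Equivalence.to T-≡ (≡⇒≡ᵇ a b eq)
  triple-exists eq₁ eq₀ (suc k) with triple-exists eq₁ eq₀ k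
  ... | S , eq = false ∷ S , eq

  count-∧false : ∀ {n} (p : Subset n → Bool) → count (λ S → p S ∧ false) ≡ 0
  count-∧false {n} p = trans (count-cong _ (λ _ → false) (∧-zeroʳ ∘ p)) (count-false n)

  count-class : ∀ j b {n} (P : Subset n) → count (λ S → mono j b S ∧ S ⊆ᵇ P) ≡ class b P C j
  count-class zero    b [] = refl
  count-class (suc j) b [] = refl
  count-class j b {suc n} (false ∷ P) = trans (cong₂ _+_ (count-class j b P)
    (count-∧false {n} (λ S → mono j b (true ∷ S)))) (+-identityʳ _)
  count-class zero b {suc n} (true ∷ P) =
    trans (cong₂ _+_ (trans (count-class zero b P) (nC0≡1 (class b P))) (count-false n))
          (sym (nC0≡1 (class b (true ∷ P))))
  count-class (suc j) b {suc n} (true ∷ P) with colour n ≡ᵇ b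
  ... | true  = trans (cong₂ _+_ (count-class (suc j) b P) (count-class j b P))
                  (trans (+-comm (class b P C suc j) _) (sym (pascal (class b P) j)))
  ... | false = trans (cong₂ _+_ (count-class (suc j) b P) (count-false n)) (+-identityʳ _)

  class-on : ∀ {n} (P : Subset n) → class (colour n) (true ∷ P) ≡ suc (class (colour n) P)
  class-on {n} P with colour n ≡ᵇ colour n | Equivalence.to T-≡ (≡⇒≡ᵇ (colour n) _ refl)
  ... | true | refl = refl

  class-off : ∀ {n} (P : Subset n) b → b ≢ colour n → class b (true ∷ P) ≡ class b P
  class-off {n} P b b≢ with colour n ≡ᵇ b in eq
  ... | false = refl
  ... | true  = ⊥-elim (b≢ (sym (≡ᵇ⇒≡ (colour n) b (Equivalence.from T-≡ eq))))

  module _ (B : ℕ) where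

    ∣∣≡Σclass : ∀ {n} (P : Subset n) → (∀ i → i < n → colour i < B) → ∣ P ∣ ≡ Σ< B (λ b → class b P)
    ∣∣≡Σclass []          bnd = sym (trans (Σ<-const B 0) (*-zeroʳ B))
    ∣∣≡Σclass (false ∷ P) bnd = ∣∣≡Σclass P (λ i i<n → bnd i (m<n⇒m<1+n i<n))
    ∣∣≡Σclass {suc n} (true ∷ P) bnd =
      trans (cong suc (∣∣≡Σclass P (λ i i<n → bnd i (m<n⇒m<1+n i<n))))
        (sym (Σ<-update (λ b → class b P) (λ b → class b (true ∷ P)) (bnd n ≤-refl) (class-on P) (class-off P)))

    -- A new element of block b completes `class b P C 2` triples, which is the Pascal increment of
    -- `class b P C 3`.
    count-triple : ∀ {n} (P : Subset n) → (∀ i → i < n → colour i < B) →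
                   count (λ S → triple S ∧ S ⊆ᵇ P) ≡ Σ< B (λ b → class b P C 3)
    count-triple []          bnd = sym (trans (Σ<-const B 0) (*-zeroʳ B))
    count-triple {suc n} (false ∷ P) bnd = trans (cong₂ _+_ (count-triple P (λ i i<n → bnd i (m<n⇒m<1+n i<n)))
      (count-∧false {n} (λ S → triple (true ∷ S)))) (+-identityʳ _)
    count-triple {suc n} (true ∷ P) bnd = trans
      (cong₂ _+_ (count-triple P (λ i i<n → bnd i (m<n⇒m<1+n i<n))) (count-class 2 (colour n) P))
      (trans (+-comm _ (class (colour n) P C 2))
        (sym (Σ<-update (λ b → class b P C 3) (λ b → class b (true ∷ P) C 3) (bnd n ≤-refl)
          (trans (cong (_C 3) (class-on P)) (pascal (class (colour n) P) 2))
          (λ b b≢ → cong (_C 3) (class-off P b b≢)))))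

  -- Each triple is charged to its largest position, which leaves at most m² choices for the other
  -- two. The block size is later fitted to this bound.
  count-triple-≤ : ∀ {m} → (∀ b n → class b (full n) ≤ m) → ∀ n → count {n} triple ≤ n * (m * m)
  count-triple-≤ bnd zero = z≤n
  count-triple-≤ {m} bnd (suc n) = begin
    count {n} triple + count {n} (mono 2 (colour n))
      ≤⟨ +-mono-≤ (count-triple-≤ bnd n) (≤-reflexive (count-cong (mono 2 (colour n))
           (λ S → mono 2 (colour n) S ∧ S ⊆ᵇ full n)
           λ S → sym (trans (cong (mono 2 (colour n) S ∧_) (⊆ᵇ-full S)) (∧-identityʳ _)))) ⟩
    n * (m * m) + count (λ S → mono 2 (colour n) S ∧ S ⊆ᵇ full n)
      ≡⟨ cong (_+_ (n * (m * m))) (count-class 2 (colour n) (full n)) ⟩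
    n * (m * m) + class (colour n) (full n) C 2
      ≤⟨ +-monoʳ-≤ (n * (m * m)) (≤-trans (C2≤square (class (colour n) (full n))) (*-mono-≤ (bnd _ n) (bnd _ n))) ⟩
    n * (m * m) + m * m ≡⟨ +-comm _ (m * m) ⟩
    suc n * (m * m) ∎
    where open ≤-Reasoning

module Blocks (m : ℕ) .{{_ : NonZero m}} where

  open Monochromatic (ℕ._/ m) public

  -- The bound by `m` alone does not pass through the induction. The first component does, and when
  -- position `n` lies in block b it equals `n % m`, which leaves room for one more element.
  class-full-≤ : ∀ b n → class b (full n) ≤ n ∸ b * m × class b (full n) ≤ m
  class-full-≤ b zero    = z≤n , z≤n
  class-full-≤ b (suc n) with n ℕ./ m ≡ᵇ b in eq | class-full-≤ b n
  ... | false | ih₁ , ih₂ = ≤-trans ih₁ (∸-monoˡ-≤ (b * m) (n≤1+n n)) , ih₂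
  ... | true  | ih₁ , ih₂ with ≡ᵇ⇒≡ (n ℕ./ m) b (Equivalence.from T-≡ eq)
  ...   | refl = ≤-trans (s≤s ih₁) (≤-reflexive (sym (+-∸-assoc 1 (m/n*n≤m n m)))) ,
                 ≤-trans (s≤s ih₁) (≤-trans (s≤s (≤-reflexive rem)) (m%n<n n m))
    where
    rem : n ∸ n ℕ./ m * m ≡ n % m
    rem = trans (cong (_∸ n ℕ./ m * m) (m≡m%n+[m/n]*n n m)) (m+n∸n≡m (n % m) (n ℕ./ m * m))

  module Forms (n : ℕ) where

    -- Entries away from the triples are free: they scale all counts alike and leave densities
    -- unchanged, which spares an indexing of the triples.
    coefficients : Vec Bool (size n) → Subset n → 𝔽₂
    coefficients c S = triple S ∧ lookup c (index S)

    form : Vec Bool (size n) → 𝔽₂^ n → 𝔽₂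
    form c = eval (coefficients c)

    -- Stated up to pointwise equality because composing a form with the identity bijection yields
    -- only a pointwise equal function.
    anf-form : ∀ c (g : 𝔽₂^ n → 𝔽₂) → (∀ x → g x ≡ form c x) → ∀ S → anf g S ≡ coefficients c S
    anf-form c g eq S = sym (anf-unique g (coefficients c) (λ x → sym (eq x)) S)

    sparsity-form : ∀ c g → (∀ x → g x ≡ form c x) → sparsity g ≤ n * (m * m)
    sparsity-form c g eq = begin
      sparsity g     ≡⟨ sparsity≡count g ⟩
      count (anf g)  ≤⟨ count-mono (anf g) triple (λ S aS → ∧-conicalˡ (triple S) _ (trans (sym (anf-form c g eq S)) aS)) ⟩
      count {n} triple ≤⟨ count-triple-≤ (λ b k → proj₂ (class-full-≤ b k)) n ⟩
      n * (m * m)    ∎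
      where open ≤-Reasoning

    subsets-complete : ∀ {n} (S : Subset n) → S ∈ subsets n
    subsets-complete []          = here refl
    subsets-complete (false ∷ S) = ∈-++⁺ˡ (∈-map⁺ (false ∷_) (subsets-complete S))
    subsets-complete (true ∷ S)  = ∈-++⁺ʳ _ (∈-map⁺ (true ∷_) (subsets-complete S))

    degree-form : ∀ c S → coefficients c S ≡ true → degree (form c) ≡ 3
    degree-form c S cS = ≤-antisym
      (max≤v⁺ z≤n (All.map⁺ (All.tabulate λ {T} T∈ → ≤-reflexive (support-size T T∈))))
      (v≤max⁺ 0 _ (inj₂ (lose (∈-map⁺ ∣_∣ S∈) (≤-reflexive (sym (support-size S S∈))))))
      where
      anf-S : ∀ T → anf (form c) T ≡ coefficients c T
      anf-S = anf-form c (form c) (λ _ → refl)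
      support-size : ∀ T → T ∈ support (form c) → ∣ T ∣ ≡ 3
      support-size T T∈ = triple-size T (∧-conicalˡ (triple T) _ (trans (sym (anf-S T))
        (Equivalence.to T-≡ (proj₂ (∈-filter⁻ (T? ∘ anf (form c)) {xs = subsets n} T∈)))))
      S∈ : S ∈ support (form c)
      S∈ = ∈-filter⁺ (T? ∘ anf (form c)) (subsets-complete S) (Equivalence.from T-≡ (trans (anf-S S) cS))

    Varies : ∀ {k} → 𝔽₂^ n → Vec (𝔽₂^ n) k → (𝔽₂^ n → 𝔽₂) → Set
    Varies a vs f = ∃[ c ] ∃[ d ] f (a ⊕ combination c vs) ≢ f (a ⊕ combination d vs)

    independent? : ∀ {k} (vs : Vec (𝔽₂^ n) k) → Dec (LinearlyIndependent vs)
    independent? {k} vs = all? (any𝔽₂? k) λ c → (combination c vs ≟ᵛ 𝟎) →-dec (c ≟ᵛ 𝟎)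

    varies? : ∀ {k} a (vs : Vec (𝔽₂^ n) k) f → Dec (Varies a vs f)
    varies? {k} a vs f = any𝔽₂? k λ c → any𝔽₂? k λ d → ¬? (f _ ≟ᵇ f _)

    constant : ∀ {k} a (vs : Vec (𝔽₂^ n) k) f → ¬ Varies a vs f →
               ∀ c d → f (a ⊕ combination c vs) ≡ f (a ⊕ combination d vs)
    constant a vs f ¬v c d = decidable-stable (f _ ≟ᵇ f _) λ neq → ¬v (c , d , neq)

    -- Shift and basis share one vector so that `unionBound-Vec` applies. Dependent families are
    -- never bad, hence the union may run over all families.
    Bad : ∀ {k} → Vec (𝔽₂^ n) (suc k) → Vec Bool (size n) → Set
    Bad (a ∷ vs) c = LinearlyIndependent vs × ¬ Varies a vs (form c)

    bad? : ∀ {k} (F : Vec (𝔽₂^ n) (suc k)) c → Dec (Bad F c)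
    bad? (a ∷ vs) c = independent? vs ×-dec ¬? (varies? a vs (form c))

    -- A cubic form whose monomials lie inside the set P of pivots depends only
    -- on the coordinates in P; these are arbitrary on the flat, so constancy on
    -- the flat forces the form to vanish.
    bad-determined : ∀ {k} a (vs : Vec (𝔽₂^ n) k) (P : Subset n) →
      (∀ y → ∃[ c ] AgreeOn P (combination c vs) y) →
      ∀ c d → ¬ Varies a vs (form c) → ¬ Varies a vs (form d) →
      AgreeOff (table (λ S → triple S ∧ S ⊆ᵇ P)) c d → c ≡ d
    bad-determined a vs P span c d ¬vc ¬vd agree = lookup-index-ext c d same
      where
      Q : Subset n → Bool
      Q S = triple S ∧ S ⊆ᵇ P
      off : ∀ S → Q S ≡ false → lookup c (index S) ≡ lookup d (index S)
      off S eq = agree (index S) (trans (lookup-table Q S) eq)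
      γ : Subset n → 𝔽₂
      γ S = coefficients c S xor coefficients d S
      γ-off : ∀ S → Q S ≡ false → γ S ≡ false
      γ-off S eq = trans (cong (λ b → (triple S ∧ b) xor coefficients d S) (off S eq))
        (xor-same (coefficients d S))
      γ-supp : ∀ S → S ⊆ᵇ P ≡ false → γ S ≡ false
      γ-supp S eq = γ-off S (trans (cong (triple S ∧_) eq) (∧-zeroʳ (triple S)))
      -- The target is `a ⊕ y` because the shift by `a` is added back in `point`.
      lift : 𝔽₂^ n → 𝔽₂^ _
      lift y = proj₁ (span (a ⊕ y))
      point : 𝔽₂^ n → 𝔽₂^ n
      point y = a ⊕ combination (lift y) vs
      point-agree : ∀ y → AgreeOn P (point y) y
      point-agree y i eq = trans (lookup-⊕ i a _) (trans (cong (lookup a i xor_)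
        (trans (proj₂ (span (a ⊕ y)) i eq) (lookup-⊕ i a y))) (cancel (lookup a i) _))
        where
        cancel : ∀ u v → u xor (u xor v) ≡ v
        cancel false v     = refl
        cancel true  false = refl
        cancel true  true  = refl
      eval-γ : ∀ x → eval γ x ≡ form c x xor form d x
      eval-γ = eval-xor (coefficients c) (coefficients d)
      vanish : ∀ y → eval γ y ≡ false
      -- The difference of the forms is constant on the flat. Comparison with the point whose pivot
      -- coordinates are 0 identifies this constant as the coefficient of the empty set, which is no
      -- triple.
      vanish y = begin
        eval γ y            ≡⟨ eval-agree P γ γ-supp _ _ (point-agree y) ⟨
        eval γ (point y)    ≡⟨ eval-γ (point y) ⟩
        form c (point y) xor form d (point y)
          ≡⟨ cong₂ _xor_ (constant a vs (form c) ¬vc (lift y) (lift 𝟎)) (constant a vs (form d) ¬vd (lift y) (lift 𝟎)) ⟩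
        form c (point 𝟎) xor form d (point 𝟎)
                            ≡⟨ eval-γ (point 𝟎) ⟨
        eval γ (point 𝟎)    ≡⟨ eval-agree P γ γ-supp _ _ (point-agree 𝟎) ⟩
        eval γ 𝟎            ≡⟨ eval-𝟎 γ ⟩
        γ 𝟎                 ≡⟨ cong (λ t → (t ∧ _) xor (t ∧ lookup d (index {n} 𝟎))) (triple-𝟎 n) ⟩
        false               ∎
        where open ≡-Reasoning
      xor≡false : ∀ u v → u xor v ≡ false → u ≡ v
      xor≡false false v    eq = sym eq
      xor≡false true  true eq = refl
      same : ∀ S → lookup c (index S) ≡ lookup d (index S)
      same S with triple S in eq
      ... | false = off S (cong (_∧ S ⊆ᵇ P) eq)
      ... | true  = xor≡false _ _ (trans
              (cong (λ t → (t ∧ lookup c (index S)) xor (t ∧ lookup d (index S))) (sym eq))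
              (eval-zero⇒zero γ vanish S))

    count-bad : ∀ B e (F : Vec (𝔽₂^ n) (suc (B * e))) → (∀ i → i < n → i ℕ./ m < B) →
                count (does ∘ bad? F) * 2 ^ (B * (e C 3)) ≤ 2 ^ size n
    count-bad B e F@(a ∷ vs) bnd with independent? vs
    ... | no ¬li = ≤-trans (≤-reflexive (cong (_* 2 ^ (B * (e C 3))) none)) z≤n
      where
      none : count (does ∘ bad? F) ≡ 0
      none = trans (count-cong _ (λ _ → false) λ c → dec-false (bad? F c) (¬li ∘ proj₁))
                   (count-false (size n))
    ... | yes li with pivots vs li
    ...   | P , ∣P∣ , span = begin
      count p * 2 ^ (B * (e C 3))
        ≤⟨ *-monoʳ-≤ (count p) (^-monoʳ-≤ 2 enough) ⟩
      count p * 2 ^ ∣ Q ∣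
        ≤⟨ count-determined Q p (λ c d pc pd → bad-determined a vs P span c d (sound c pc) (sound d pd)) ⟩
      2 ^ size n ∎
      where
      open ≤-Reasoning
      p : Vec Bool (size n) → Bool
      p = does ∘ bad? F
      Q : Subset (size n)
      Q = table (λ S → triple S ∧ S ⊆ᵇ P)
      sound : ∀ c → p c ≡ true → ¬ Varies a vs (form c)
      sound c eq = proj₂ (does-true (bad? F c) eq)
      enough : B * (e C 3) ≤ ∣ Q ∣
      enough = begin
        B * (e C 3)                       ≤⟨ Σ<-C3-convex B e (λ b → class b P) (trans (sym (∣∣≡Σclass B P bnd)) ∣P∣) ⟩
        Σ< B (λ b → class b P C 3)        ≡⟨ count-triple B P bnd ⟨
        count (λ S → triple S ∧ S ⊆ᵇ P)   ≡⟨ ∣table∣ (λ S → triple S ∧ S ⊆ᵇ P) ⟨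
        ∣ Q ∣                              ∎

    -- Degree exactly 3 requires a nonzero coefficient. `avoid` promises none, so the case of a zero
    -- form is treated apart.
    good-form : ∀ B e → (∀ i → i < n → i ℕ./ m < B) → n * suc (B * e) < B * (e C 3) →
      ∃[ S ] triple {n} S ≡ true →
      ∃[ c ] (∃[ S ] coefficients c S ≡ true) ×
        (∀ a (vs : Vec (𝔽₂^ n) (B * e)) → LinearlyIndependent vs → Varies a vs (form c))
    good-form B e bnd few (S , tS)
      with avoid flats-bound {r = B * (e C 3)} (λ F c → does (bad? F c)) (λ F → count-bad B e F bnd) few
      where
      flats-bound : UnionBound (Vec (𝔽₂^ n) (suc (B * e))) (2 ^ (n * suc (B * e)))
      flats-bound = subst (UnionBound _) (^-*-assoc 2 n (suc (B * e)))
        (unionBound-Vec {N = 2 ^ n} (unionBound-Vec {N = 2} unionBound-Bool n) (suc (B * e)))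
    ... | c , avoids with any𝔽₂? n (λ S → coefficients c S ≟ᵇ true)
    ...   | yes found = c , found , good
      where
      good : ∀ a (vs : Vec (𝔽₂^ n) (B * e)) → LinearlyIndependent vs → Varies a vs (form c)
      good a vs li = decidable-stable (varies? a vs (form c)) λ ¬v →
        does-false (bad? (a ∷ vs) c) (avoids (a ∷ vs)) (li , ¬v)
    -- If the zero form is good then there are no independent families at all.
    ...   | no none = replicate _ true , (S , cong₂ _∧_ tS (lookup-replicate (index S) true)) ,
        λ a vs li → ⊥-elim (does-false (bad? (a ∷ vs) c) (avoids (a ∷ vs))
          (li , λ (x , y , neq) → neq (trans (zero-form _) (sym (zero-form _)))))
      where
      zero-form : ∀ x → form c x ≡ false
      zero-form = eval-zero (coefficients c) λ T → ¬-not λ eq → none (T , eq)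

-- Powers with rational exponents

toℚᵘ-/ : ∀ a d → toℚᵘ (+ a / suc d) ℚᵘ.≃ mkℚᵘ (+ a) d
toℚᵘ-/ a d = ℚ.toℚᵘ-fromℚᵘ (mkℚᵘ (+ a) d)

/-≡ : ∀ a c b d .{{_ : NonZero c}} .{{_ : NonZero d}} → a * d ≡ b * c → + a / c ≡ + b / d
/-≡ a (suc c) b (suc d) eq = ℚ.fromℚᵘ-cong {mkℚᵘ (+ a) c} {mkℚᵘ (+ b) d}
  (*≡* (trans (sym (ℤ.pos-* a (suc d))) (trans (cong +_ eq) (ℤ.pos-* b (suc c)))))

/-< : ∀ a c b d .{{_ : NonZero c}} .{{_ : NonZero d}} → a * d < b * c → + a / c ℚ.< + b / d
/-< a (suc c) b (suc d) lt = ℚ.toℚᵘ-cancel-<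
  (ℚᵘ.<-respˡ-≃ (ℚᵘ.≃-sym (toℚᵘ-/ a c)) (ℚᵘ.<-respʳ-≃ (ℚᵘ.≃-sym (toℚᵘ-/ b d))
    (*<* (subst₂ ℤ._<_ (ℤ.pos-* a (suc d)) (ℤ.pos-* b (suc c)) (ℤ.+<+ lt)))))

/-<⁻¹ : ∀ a c b d .{{_ : NonZero c}} .{{_ : NonZero d}} → + a / c ℚ.< + b / d → a * d < b * c
/-<⁻¹ a (suc c) b (suc d) lt
  with ℚᵘ.<-respˡ-≃ (toℚᵘ-/ a c) (ℚᵘ.<-respʳ-≃ (toℚᵘ-/ b d) (ℚ.toℚᵘ-mono-< lt))
... | *<* lt′ = ℤ.drop‿+<+ (subst₂ ℤ._<_ (sym (ℤ.pos-* a (suc d))) (sym (ℤ.pos-* b (suc c))) lt′)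

/-* : ∀ a c b d .{{_ : NonZero c}} .{{_ : NonZero d}} →
      (+ a / c) ℚ.* (+ b / d) ≡ _/_ (+ (a * b)) (c * d) {{m*n≢0 c d}}
/-* a (suc c) b (suc d) = ℚ.toℚᵘ-injective (begin-equality
  toℚᵘ ((+ a / suc c) ℚ.* (+ b / suc d))         ≃⟨ ℚ.toℚᵘ-homo-* (+ a / suc c) (+ b / suc d) ⟩
  toℚᵘ (+ a / suc c) ℚᵘ.* toℚᵘ (+ b / suc d)     ≃⟨ ℚᵘ.*-cong (toℚᵘ-/ a c) (toℚᵘ-/ b d) ⟩
  mkℚᵘ (+ a) c ℚᵘ.* mkℚᵘ (+ b) d                 ≡⟨ cong (λ i → mkℚᵘ i (d + c * suc d)) (ℤ.pos-* a b) ⟨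
  mkℚᵘ (+ (a * b)) (d + c * suc d)               ≃⟨ toℚᵘ-/ (a * b) _ ⟨
  toℚᵘ (+ (a * b) / (suc c * suc d))             ∎)
  where open ℚᵘ.≤-Reasoning

/-+ : ∀ a c b d .{{_ : NonZero c}} .{{_ : NonZero d}} →
      (+ a / c) ℚ.+ (+ b / d) ≡ _/_ (+ (a * d + b * c)) (c * d) {{m*n≢0 c d}}
/-+ a (suc c) b (suc d) = ℚ.toℚᵘ-injective (begin-equality
  toℚᵘ ((+ a / suc c) ℚ.+ (+ b / suc d))         ≃⟨ ℚ.toℚᵘ-homo-+ (+ a / suc c) (+ b / suc d) ⟩
  toℚᵘ (+ a / suc c) ℚᵘ.+ toℚᵘ (+ b / suc d)     ≃⟨ ℚᵘ.+-cong (toℚᵘ-/ a c) (toℚᵘ-/ b d) ⟩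
  mkℚᵘ (+ a) c ℚᵘ.+ mkℚᵘ (+ b) d
    ≡⟨ cong (λ i → mkℚᵘ i (d + c * suc d)) (cong₂ ℤ._+_ (ℤ.pos-* a (suc d)) (ℤ.pos-* b (suc c))) ⟨
  mkℚᵘ (+ (a * suc d + b * suc c)) (d + c * suc d) ≃⟨ toℚᵘ-/ _ _ ⟨
  toℚᵘ (+ (a * suc d + b * suc c) / (suc c * suc d)) ∎)
  where open ℚᵘ.≤-Reasoning

/-^ : ∀ a c k .{{_ : NonZero c}} → (+ a / c) ^ℚ k ≡ _/_ (+ (a ^ k)) (c ^ k) {{m^n≢0 c k}}
/-^ a c zero    = refl
/-^ a c (suc k) {{nz}} = trans (cong ((+ a / c) ℚ.*_) (/-^ a c k))
  (/-* a c (a ^ k) (c ^ k) {{nz}} {{m^n≢0 c k}})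

-- `_/_` cancels common factors, and powers with rational exponents are compared through the reduced
-- fraction. The cross product links the two pairs of exponents.
reduced : ∀ a d .{{_ : NonZero d}} → ∃[ α ] ↥ (+ a / d) ≡ + α × α * d ≡ a * ↧ₙ (+ a / d)
reduced a (suc d) with + a / suc d | toℚᵘ-/ a d
... | mkℚ (+ α)    δ _ | *≡* eq = α , refl ,
  ℤ.+-injective (trans (ℤ.pos-* α (suc d)) (trans eq (sym (ℤ.pos-* a (suc δ)))))
... | mkℚ -[1+ α ] δ _ | *≡* eq with trans eq (sym (ℤ.pos-* a (suc δ)))
...   | ()

^-distribʳ-* : ∀ a b k → (a * b) ^ k ≡ a ^ k * b ^ k
^-distribʳ-* a b zero    = refl
^-distribʳ-* a b (suc k) = trans (cong (a * b *_) (^-distribʳ-* a b k)) (lemma a b (a ^ k) (b ^ k))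
  where
  lemma : ∀ a b x y → a * b * (x * y) ≡ a * x * (b * y)
  lemma = solve-∀

^-cancelˡ-≤ : ∀ {a b} k .{{_ : NonZero k}} → a ^ k ≤ b ^ k → a ≤ b
^-cancelˡ-≤ k le = ≮⇒≥ λ b<a → <⇒≱ (^-monoˡ-< k b<a) le

^-cancelˡ-< : ∀ {a b} k → a ^ k < b ^ k → a < b
^-cancelˡ-< k lt = ≰⇒> λ b≤a → <⇒≱ lt (^-monoˡ-≤ k b≤a)

^-^-comm : ∀ a j k → (a ^ j) ^ k ≡ (a ^ k) ^ j
^-^-comm a j k = trans (^-*-assoc a j k) (trans (cong (a ^_) (*-comm j k)) (sym (^-*-assoc a k j)))

-- Raising the hypothesis to the reduced denominator and taking d-th roots gives the same bound for
-- the reduced exponent; a nonnegative q = i/j below t satisfies i < t j.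
below-power : ∀ n .{{_ : NonZero n}} t a d .{{_ : NonZero d}} → t ^ d ≤ n ^ a →
              ∀ q → q ℚ.< + t / 1 → q <[ n ^ + a / d ]
below-power n t a d t^d≤n^a q@(mkℚ -[1+ _ ] _ _) q<t = inj₁ (ℚ.negative⁻¹ q)
below-power n t a d t^d≤n^a q@(mkℚ (+ i) j-1 _) q<t with reduced a d
... | α , ↥≡ , α*d≡a*δ = inj₂ (subst₂ ℚ._<_ (cong (_^ℚ δ) (ℚ.↥p/↧p≡p q)) (cong (n ^ℤ_) (sym ↥≡))
    (subst (ℚ._< + (n ^ α) / 1) (sym (/-^ i j δ)) (/-< (i ^ δ) (j ^ δ) (n ^ α) 1 {{m^n≢0 j δ}} cross)))
  where
  δ = ↧ₙ (+ a / d)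
  j = suc j-1
  root : t ^ δ ≤ n ^ α
  root = ^-cancelˡ-≤ d (begin
    (t ^ δ) ^ d     ≡⟨ ^-^-comm t δ d ⟩
    (t ^ d) ^ δ     ≤⟨ ^-monoˡ-≤ δ t^d≤n^a ⟩
    (n ^ a) ^ δ     ≡⟨ ^-*-assoc n a δ ⟩
    n ^ (a * δ)     ≡⟨ cong (n ^_) α*d≡a*δ ⟨
    n ^ (α * d)     ≡⟨ ^-*-assoc n α d ⟨
    (n ^ α) ^ d     ∎)
    where open ≤-Reasoning
  i<tj : i < t * j
  i<tj = subst (_< t * j) (*-identityʳ i) (/-<⁻¹ i j t 1 (subst (ℚ._< + t / 1) (sym (ℚ.↥p/↧p≡p q)) q<t))
  cross : i ^ δ * 1 < n ^ α * j ^ δ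
  cross = begin-strict
    i ^ δ * 1        ≡⟨ *-identityʳ (i ^ δ) ⟩
    i ^ δ            <⟨ ^-monoˡ-< δ i<tj ⟩
    (t * j) ^ δ      ≡⟨ ^-distribʳ-* t j δ ⟩
    t ^ δ * j ^ δ    ≤⟨ *-monoˡ-≤ (j ^ δ) root ⟩
    n ^ α * j ^ δ    ∎
    where open ≤-Reasoning

fraction-below-power : ∀ n .{{_ : NonZero n}} x y .{{_ : NonZero y}} a d .{{_ : NonZero d}} →
  x ^ d < n ^ a * y ^ d → (+ x / y) <[ n ^ + a / d ]
fraction-below-power n x y a d lt with reduced a d
... | α , ↥≡ , α*d≡a*δ = inj₂ (subst₂ ℚ._<_ (sym (/-^ x y δ)) (cong (n ^ℤ_) (sym ↥≡))
    (/-< (x ^ δ) (y ^ δ) (n ^ α) 1 {{m^n≢0 y δ}} (subst (_< n ^ α * y ^ δ) (sym (*-identityʳ (x ^ δ))) root)))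
  where
  δ = ↧ₙ (+ a / d)
  root : x ^ δ < n ^ α * y ^ δ
  root = ^-cancelˡ-< d (begin-strict
    (x ^ δ) ^ d                 ≡⟨ ^-^-comm x δ d ⟩
    (x ^ d) ^ δ                 <⟨ ^-monoˡ-< δ lt ⟩
    (n ^ a * y ^ d) ^ δ         ≡⟨ ^-distribʳ-* (n ^ a) (y ^ d) δ ⟩
    (n ^ a) ^ δ * (y ^ d) ^ δ   ≡⟨ cong₂ _*_ (^-*-assoc n a δ) (^-^-comm y d δ) ⟩
    n ^ (a * δ) * (y ^ δ) ^ d   ≡⟨ cong (λ e → n ^ e * (y ^ δ) ^ d) α*d≡a*δ ⟨
    n ^ (α * d) * (y ^ δ) ^ d   ≡⟨ cong (_* (y ^ δ) ^ d) (^-*-assoc n α d) ⟨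
    (n ^ α) ^ d * (y ^ δ) ^ d   ≡⟨ ^-distribʳ-* (n ^ α) (y ^ δ) d ⟨
    (n ^ α * y ^ δ) ^ d         ∎)
    where open ≤-Reasoning

-- Locatedness only separates neighbouring grid points, so s is caught in an
-- interval of length 2/d.
bracket : ∀ {s} → IsReal s → fromℕ 2 <ᶜ s → s ≤ᶜ fromℕ 3 → ∀ d .{{_ : NonZero d}} →
  ∃[ a ] 2 * d ≤ a × a < 3 * d × lower s (+ a / d) × upper s (+ (2 + a) / d)
bracket {s} real (q , 2<q , q<s) s≤3 d = search d (2 * d) ≤-refl refl
  (Equivalence.from (IsReal.lower-rounded real _)
    (q , subst (ℚ._< q) (/-≡ 2 1 (2 * d) d (sym (*-identityʳ (2 * d)))) 2<q , q<s))
  where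
  below-3 : ∀ a → lower s (+ a / d) → a < 3 * d
  below-3 a low = subst (_< 3 * d) (*-identityʳ a) (/-<⁻¹ a d 3 1 (s≤3 _ low))
  search : ∀ j a → 2 * d ≤ a → j + a ≡ 3 * d → lower s (+ a / d) →
    ∃[ a ] 2 * d ≤ a × a < 3 * d × lower s (+ a / d) × upper s (+ (2 + a) / d)
  -- Here a = 3d, and 3 below s would contradict s ≤ 3.
  search zero a 2d≤a eq low = ⊥-elim (<⇒≢ (below-3 a low) eq)
  search (suc j) a 2d≤a eq low
    with IsReal.located real (+ (1 + a) / d) (+ (2 + a) / d) (/-< (1 + a) d (2 + a) d (*-monoˡ-< d (n<1+n (1 + a))))
  ... | inj₂ up   = a , 2d≤a , below-3 a low , low , up
  ... | inj₁ low′ = search j (suc a) (m≤n⇒m≤1+n 2d≤a) (trans (+-suc j a) eq) low′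

-- g / 2d = (2 - ½ (2 + a) / d) - 1 / 2d, the last term because lower cuts are open.
exponent-below : ∀ {s} a g d .{{_ : NonZero d}} → g + (3 + a) ≡ 4 * d → upper s (+ (2 + a) / d) →
  lower (fromℕ 2 -ᶜ ½ ·ᶜ s) (_/_ (+ g) (2 * d) {{m*n≢0 2 d}})
exponent-below a g d eq up = x , h , x<2 , (_ , up , refl) , sym (begin
    x ℚ.- h                 ≡⟨ ℚ.+-assoc r h (ℚ.- h) ⟩
    r ℚ.+ (h ℚ.- h)         ≡⟨ cong (r ℚ.+_) (ℚ.+-inverseʳ h) ⟩
    r ℚ.+ ℚ.0ℚ              ≡⟨ ℚ.+-identityʳ r ⟩
    r                       ∎)
  where
  open ≡-Reasoning
  instance
    _ = m*n≢0 2 d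
    _ = m*n≢0 (2 * d) (2 * d)
  r = + g / (2 * d)
  h = ½ ℚ.* (+ (2 + a) / d)
  -- This is 2 - 1/2d. Of the 3 in `g + (3 + a)`, the bracket around s takes 2 and the strict
  -- inequality x < 2 takes 1.
  x = r ℚ.+ h
  h≡ : h ≡ + (1 * (2 + a)) / (2 * d)
  h≡ = /-* 1 2 (2 + a) d
  x≡ : x ≡ + (g * (2 * d) + 1 * (2 + a) * (2 * d)) / (2 * d * (2 * d))
  x≡ = trans (cong (r ℚ.+_) h≡) (/-+ g (2 * d) (1 * (2 + a)) (2 * d))
  x<2 : x ℚ.< + 2 / 1
  x<2 = subst (ℚ._< + 2 / 1) (sym x≡) (/-< (g * (2 * d) + 1 * (2 + a) * (2 * d)) (2 * d * (2 * d)) 2 1 (subst₂ _<_ (lemma₁ g a d) lemma₂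
    (*-monoˡ-< (2 * d) (+-monoʳ-< g (≤-refl {3 + a})))))
    where
    lemma₁ : ∀ g a d → (g + (2 + a)) * (2 * d) ≡ (g * (2 * d) + 1 * (2 + a) * (2 * d)) * 1
    lemma₁ = solve-∀
    lemma₃ : ∀ d → 4 * d * (2 * d) ≡ 2 * (2 * d * (2 * d))
    lemma₃ = solve-∀
    lemma₂ : (g + (3 + a)) * (2 * d) ≡ 2 * (2 * d * (2 * d))
    lemma₂ = trans (cong (_* (2 * d)) eq) (lemma₃ d)

-- Choice of parameters

greatest : ∀ {P : Pred ℕ 0ℓ} → Decidable P → P 0 → ∀ b → ¬ P b → ∃[ m ] m < b × P m × ¬ P (suc m)
greatest P? p0 zero    ¬pb = ⊥-elim (¬pb p0)
greatest P? p0 (suc b) ¬pb with P? b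
... | yes pb  = b , ≤-refl , pb , ¬pb
... | no  ¬pb′ with greatest P? p0 b ¬pb′
...   | m , m<b , pm , ¬psm = m , m<n⇒m<1+n m<b , pm , ¬psm

isqrt : ∀ n → ∃[ u ] u * u ≤ n × n < suc u * suc u
isqrt n with greatest (λ u → u * u ≤? n) z≤n (suc n) (<⇒≱ (m≤m*n (suc n) (suc n)))
... | u , _ , u²≤n , ¬ = u , u²≤n , ≰⇒> ¬

double-C2 : ∀ x → 2 * (suc x C 2) ≡ suc x * x
double-C2 zero    = refl
double-C2 (suc x) = begin
  2 * (suc (suc x) C 2)           ≡⟨ cong (2 *_) (trans (pascal (suc x) 1) (cong (_+ suc x C 2) (nC1≡n (suc x)))) ⟩
  2 * (suc x + suc x C 2)         ≡⟨ *-distribˡ-+ 2 (suc x) _ ⟩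
  2 * suc x + 2 * (suc x C 2)     ≡⟨ cong (_+_ (2 * suc x)) (double-C2 x) ⟩
  2 * suc x + suc x * x           ≡⟨ lemma x ⟩
  suc (suc x) * suc x             ∎
  where
  open ≡-Reasoning
  lemma : ∀ x → 2 * suc x + suc x * x ≡ suc (suc x) * suc x
  lemma = solve-∀

six-C3 : ∀ x → 6 * (suc (suc x) C 3) ≡ suc (suc x) * suc x * x
six-C3 zero    = refl
six-C3 (suc x) = begin
  6 * (suc (suc (suc x)) C 3)                             ≡⟨ cong (6 *_) (pascal (suc (suc x)) 2) ⟩
  6 * (suc (suc x) C 2 + suc (suc x) C 3)                 ≡⟨ lemma₁ (suc (suc x) C 2) _ ⟩
  3 * (2 * (suc (suc x) C 2)) + 6 * (suc (suc x) C 3)     ≡⟨ cong₂ (λ p q → 3 * p + q) (double-C2 (suc x)) (six-C3 x) ⟩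
  3 * (suc (suc x) * suc x) + suc (suc x) * suc x * x     ≡⟨ lemma₂ x ⟩
  suc (suc (suc x)) * suc (suc x) * suc x                 ∎
  where
  open ≡-Reasoning
  lemma₁ : ∀ p q → 6 * (p + q) ≡ 3 * (2 * p) + 6 * q
  lemma₁ = solve-∀
  lemma₂ : ∀ x → 3 * (suc (suc x) * suc x) + suc (suc x) * suc x * x ≡ suc (suc (suc x)) * suc (suc x) * suc x
  lemma₂ = solve-∀

-- After multiplication by 6 the leading terms are 18u³ against 27u³. The inequality first holds at
-- u = 8, and in terms of v the difference has positive coefficients only. Here u² + 2u is the
-- largest n with integer square root u.
C3-large : ∀ v → let u = 8 + v in (u * u + 2 * u) * (1 + 3 * u) < 3 * u C 3
C3-large v = *-cancelˡ-< 6 _ _ (begin-strict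
  6 * ((u * u + 2 * u) * (1 + 3 * u))   <⟨ m<m+n _ (s≤s z≤n) ⟩
  6 * ((u * u + 2 * u) * (1 + 3 * u)) + suc (9 * v * v * v + 147 * v * v + 618 * v + 143)
                                         ≡⟨ lemma v ⟩
  suc (suc x) * suc x * x               ≡⟨ six-C3 x ⟨
  6 * (suc (suc x) C 3)                 ≡⟨ cong (λ y → 6 * (y C 3)) (lemma₂ v) ⟩
  6 * (3 * u C 3)                       ∎)
  where
  open ≤-Reasoning
  u = 8 + v
  x = 22 + 3 * v
  lemma : ∀ v → 6 * (((8 + v) * (8 + v) + 2 * (8 + v)) * (1 + 3 * (8 + v)))
                  + (1 + (9 * v * v * v + 147 * v * v + 618 * v + 143))
                ≡ (24 + 3 * v) * (23 + 3 * v) * (22 + 3 * v)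
  lemma = solve-∀
  lemma₂ : ∀ v → 24 + 3 * v ≡ 3 * (8 + v)
  lemma₂ = solve-∀

few-flats : ∀ {n} u B .{{_ : NonZero B}} → 8 ≤ u → n < suc u * suc u →
            n * suc (B * (3 * u)) < B * (3 * u C 3)
few-flats {n} u B 8≤u n<[1+u]² = begin-strict
  -- The 1 that stands for the shift is enlarged to `B`, so that `B` factors out.
  n * suc (B * (3 * u))               ≤⟨ *-monoʳ-≤ n (+-monoˡ-≤ (B * (3 * u)) (>-nonZero⁻¹ B)) ⟩
  n * (B + B * (3 * u))               ≡⟨ lemma₁ n B (3 * u) ⟩
  B * (n * (1 + 3 * u))               ≤⟨ *-monoʳ-≤ B (*-monoˡ-≤ (1 + 3 * u) (s≤s⁻¹ (≤-trans n<[1+u]² (≤-reflexive (lemma₂ u))))) ⟩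
  B * ((u * u + 2 * u) * (1 + 3 * u)) <⟨ *-monoʳ-< B large ⟩
  B * (3 * u C 3)                     ∎
  where
  open ≤-Reasoning
  large : (u * u + 2 * u) * (1 + 3 * u) < 3 * u C 3
  large = subst (λ u → (u * u + 2 * u) * (1 + 3 * u) < 3 * u C 3) (m+[n∸m]≡n 8≤u) (C3-large (u ∸ 8))
  lemma₁ : ∀ n B e → n * (B + B * e) ≡ B * (n * (1 + e))
  lemma₁ = solve-∀
  lemma₂ : ∀ u → suc u * suc u ≡ suc (u * u + 2 * u)
  lemma₂ = solve-∀

n≤2^n : ∀ n → n ≤ 2 ^ n
n≤2^n zero    = z≤n
n≤2^n (suc n) = begin
  1 + n             ≤⟨ +-mono-≤ (m^n>0 2 n) (n≤2^n n) ⟩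
  2 ^ n + 2 ^ n     ≡⟨ cong (_+_ (2 ^ n)) (+-identityʳ (2 ^ n)) ⟨
  2 * 2 ^ n         ∎
  where open ≤-Reasoning

-- 2 ≤ 1.01¹⁰⁰, hence n³ ≤ 1.01³⁰⁰ⁿ.
cube-small : ∀ n → n ^ 3 * 100 ^ (2 * (150 * n)) ≤ 101 ^ (2 * (150 * n))
cube-small n = begin
  n ^ 3 * 100 ^ (2 * (150 * n))              ≤⟨ *-monoˡ-≤ (100 ^ (2 * (150 * n))) (^-monoˡ-≤ 3 (n≤2^n n)) ⟩
  (2 ^ n) ^ 3 * 100 ^ (2 * (150 * n))        ≡⟨ cong₂ _*_ (^-*-assoc 2 n 3) (split 100) ⟩
  2 ^ (n * 3) * (100 ^ 100) ^ (n * 3)        ≡⟨ ^-distribʳ-* 2 (100 ^ 100) (n * 3) ⟨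
  (2 * 100 ^ 100) ^ (n * 3)                  ≤⟨ ^-monoˡ-≤ (n * 3) (≤ᵇ⇒≤ (2 * 100 ^ 100) (101 ^ 100) _) ⟩
  (101 ^ 100) ^ (n * 3)                      ≡⟨ split 101 ⟨
  101 ^ (2 * (150 * n))                      ∎
  where
  open ≤-Reasoning
  exponent : ∀ n → 2 * (150 * n) ≡ 100 * (n * 3)
  exponent = solve-∀
  split : ∀ k → k ^ (2 * (150 * n)) ≡ (k ^ 100) ^ (n * 3)
  split k = trans (cong (k ^_) (exponent n)) (sym (^-*-assoc k 100 (n * 3)))

-- Divided by 25 this reads 303 B (m + 1) ≤ 612 n. From m ≤ n follows B m ≤ 2n, and the extra B is
-- at most B m / 101. The scaling gives 2525 = 25 · 101 and 15300 = 153 · 100, the constants met in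
-- `base`.
block-count : ∀ n m .{{_ : NonZero m}} u → 101 ≤ u → u ≤ m → m ≤ n →
              2525 * 3 * (suc (n ℕ./ m) * suc m) ≤ 15300 * n
block-count n m u 101≤u u≤m m≤n = begin
  2525 * 3 * (B * suc m)             ≡⟨ lemma₁ B m ⟩
  7575 * (B * m) + 75 * (B * 101)    ≤⟨ +-mono-≤ (*-monoʳ-≤ 7575 Bm≤2n)
                                          (*-monoʳ-≤ 75 (≤-trans (*-monoʳ-≤ B (≤-trans 101≤u u≤m)) Bm≤2n)) ⟩
  7575 * (2 * n) + 75 * (2 * n)      ≡⟨ lemma₂ n ⟩
  15300 * n                          ∎
  where
  open ≤-Reasoning
  B = suc (n ℕ./ m)
  Bm≤2n : B * m ≤ 2 * n
  Bm≤2n = ≤-trans (+-mono-≤ m≤n (m/n*n≤m n m)) (≤-reflexive (cong (_+_ n) (sym (+-identityʳ n))))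
  lemma₁ : ∀ B m → 2525 * 3 * (B * suc m) ≡ 7575 * (B * m) + 75 * (B * 101)
  lemma₁ = solve-∀
  lemma₂ : ∀ n → 7575 * (2 * n) + 75 * (2 * n) ≡ 15300 * n
  lemma₂ = solve-∀

-- D = 3 u B satisfies D < 6.12 n^{g/2d}, as 25 / 153 = 1 / 6.12.
dimension-bound : ∀ n .{{_ : NonZero n}} m .{{_ : NonZero m}} u a g d →
  n ^ 3 * 100 ^ (2 * d) ≤ 101 ^ (2 * d) →
  101 ≤ u → u ≤ m → m ≤ n → u * u ≤ n → g + (3 + a) ≡ 4 * d →
  n ^ a < (n * (suc m * suc m)) ^ d →
  (25 * (suc (n ℕ./ m) * (3 * u))) ^ (2 * d) < n ^ g * 153 ^ (2 * d)
dimension-bound n m u a g d cube-small 101≤u u≤m m≤n u²≤n exponents n^a< =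
  -- Both sides are multiplied by the quantities that `n^a<` and `cube-small` bound, so no negative
  -- exponent occurs. What remains is an inequality of d-th powers, proved in `base`.
  *-cancelʳ-< (n ^ a * (n ^ 3 * 100 ^ (2 * d))) (X ^ (2 * d)) _ (begin-strict
    X ^ (2 * d) * (n ^ a * (n ^ 3 * 100 ^ (2 * d)))
      <⟨ *-monoʳ-< (X ^ (2 * d)) {{X^≢0}} (*-monoˡ-< (n ^ 3 * 100 ^ (2 * d)) {{n³≢0}} n^a<) ⟩
    X ^ (2 * d) * ((n * (suc m * suc m)) ^ d * (n ^ 3 * 100 ^ (2 * d)))
      ≤⟨ *-monoʳ-≤ (X ^ (2 * d)) (*-monoʳ-≤ ((n * (suc m * suc m)) ^ d) cube-small) ⟩
    X ^ (2 * d) * ((n * (suc m * suc m)) ^ d * 101 ^ (2 * d))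
      ≡⟨ cong₂ (λ p q → p * ((n * (suc m * suc m)) ^ d * q)) (^-*-assoc X 2 d) (^-*-assoc 101 2 d) ⟨
    (X ^ 2) ^ d * ((n * (suc m * suc m)) ^ d * (101 ^ 2) ^ d)
      ≡⟨ cong ((X ^ 2) ^ d *_) (^-distribʳ-* (n * (suc m * suc m)) (101 ^ 2) d) ⟨
    (X ^ 2) ^ d * (n * (suc m * suc m) * 101 ^ 2) ^ d
      ≡⟨ ^-distribʳ-* (X ^ 2) _ d ⟨
    (X ^ 2 * (n * (suc m * suc m) * 101 ^ 2)) ^ d
      ≤⟨ ^-monoˡ-≤ d base ⟩
    (n ^ 4 * (153 ^ 2 * 100 ^ 2)) ^ d
      ≡⟨ trans (^-distribʳ-* (n ^ 4) _ d) (cong ((n ^ 4) ^ d *_) (^-distribʳ-* (153 ^ 2) (100 ^ 2) d)) ⟩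
    (n ^ 4) ^ d * ((153 ^ 2) ^ d * (100 ^ 2) ^ d)
      ≡⟨ cong₂ _*_ (^-*-assoc n 4 d) (cong₂ _*_ (^-*-assoc 153 2 d) (^-*-assoc 100 2 d)) ⟩
    n ^ (4 * d) * (153 ^ (2 * d) * 100 ^ (2 * d))
      ≡⟨ cong (λ k → n ^ k * (153 ^ (2 * d) * 100 ^ (2 * d))) exponents ⟨
    n ^ (g + (3 + a)) * (153 ^ (2 * d) * 100 ^ (2 * d))
      ≡⟨ cong (_* (153 ^ (2 * d) * 100 ^ (2 * d))) (trans (^-distribˡ-+-* n g (3 + a)) (cong (n ^ g *_) (^-distribˡ-+-* n 3 a))) ⟩
    n ^ g * (n ^ 3 * n ^ a) * (153 ^ (2 * d) * 100 ^ (2 * d))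
      ≡⟨ shuffle (n ^ g) (n ^ 3) (n ^ a) (153 ^ (2 * d)) (100 ^ (2 * d)) ⟩
    n ^ g * 153 ^ (2 * d) * (n ^ a * (n ^ 3 * 100 ^ (2 * d))) ∎)
  where
  open ≤-Reasoning
  B = suc (n ℕ./ m)
  X = 25 * (B * (3 * u))
  instance
    u≢0 : NonZero u
    u≢0 = >-nonZero (≤-trans (s≤s z≤n) 101≤u)
  X^≢0 : NonZero (X ^ (2 * d))
  X^≢0 = m^n≢0 X (2 * d) {{m*n≢0 25 (B * (3 * u)) {{_}} {{m*n≢0 B (3 * u) {{_}} {{m*n≢0 3 u}}}}}}
  n³≢0 : NonZero (n ^ 3 * 100 ^ (2 * d))
  n³≢0 = m*n≢0 (n ^ 3) (100 ^ (2 * d)) {{m^n≢0 n 3}} {{m^n≢0 100 (2 * d)}}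
  shuffle : ∀ p q r s t → p * (q * r) * (s * t) ≡ p * s * (r * (q * t))
  shuffle = solve-∀
  regroup : ∀ B u m n → (25 * (B * (3 * u))) * (25 * (B * (3 * u))) * (n * (suc m * suc m) * (101 * 101))
            ≡ 2525 * 3 * (B * suc m) * (2525 * 3 * (B * suc m)) * ((u * u) * n)
  regroup = solve-∀
  regroup′ : ∀ n → 15300 * n * (15300 * n) * (n * n) ≡ n * (n * (n * n)) * (153 * 153 * (100 * 100))
  regroup′ = solve-∀
  square : ∀ x → x ^ 2 ≡ x * x
  square x = cong (x *_) (*-identityʳ x)
  fourth : n ^ 4 ≡ n * (n * (n * n))
  fourth = cong (λ y → n * (n * (n * y))) (*-identityʳ n)
  base : X ^ 2 * (n * (suc m * suc m) * 101 ^ 2) ≤ n ^ 4 * (153 ^ 2 * 100 ^ 2)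
  base = begin
    X ^ 2 * (n * (suc m * suc m) * 101 ^ 2)     ≡⟨ cong (_* (n * (suc m * suc m) * (101 * 101))) (square X) ⟩
    X * X * (n * (suc m * suc m) * (101 * 101)) ≡⟨ regroup B u m n ⟩
    2525 * 3 * (B * suc m) * (2525 * 3 * (B * suc m)) * ((u * u) * n)
      ≤⟨ *-mono-≤ (*-mono-≤ count≤ count≤) (*-monoˡ-≤ n u²≤n) ⟩
    15300 * n * (15300 * n) * (n * n)           ≡⟨ regroup′ n ⟩
    n * (n * (n * n)) * (153 * 153 * (100 * 100)) ≡⟨ cong (_* (153 * 153 * (100 * 100))) fourth ⟨
    n ^ 4 * (153 ^ 2 * 100 ^ 2)                 ∎
    where count≤ = block-count n m u 101≤u u≤m m≤n

-- m is the floor of n^{(a/d - 1) / 2}.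
block-size : ∀ n .{{_ : NonZero n}} d .{{_ : NonZero d}} a u → u * u ≤ n → 2 * d ≤ a → a < 3 * d →
  ∃[ m ] u ≤ m × m ≤ n × (n * (m * m)) ^ d ≤ n ^ a × n ^ a < (n * (suc m * suc m)) ^ d
block-size n d a u u²≤n 2d≤a a<3d
  with greatest (λ m → (n * (m * m)) ^ d ≤? n ^ a) at-0 (suc n) (<⇒≱ at-1+n)
  where
  open ≤-Reasoning
  at-0 : (n * 0) ^ d ≤ n ^ a
  at-0 = begin
    (n * 0) ^ d   ≤⟨ ^-monoˡ-≤ d (≤-trans (≤-reflexive (*-zeroʳ n)) z≤n) ⟩
    1 ^ d         ≡⟨ ^-zeroˡ d ⟩
    1             ≤⟨ m^n>0 n a ⟩
    n ^ a         ∎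
  -- The hypothesis a < 3d, which comes from s ≤ 3, keeps a block within the n variables.
  at-1+n : n ^ a < (n * (suc n * suc n)) ^ d
  at-1+n = begin-strict
    n ^ a                       ≤⟨ ^-monoʳ-≤ n (<⇒≤ a<3d) ⟩
    n ^ (3 * d)                 ≡⟨ ^-*-assoc n 3 d ⟨
    (n ^ 3) ^ d                 ≡⟨ cong (λ y → (n * (n * y)) ^ d) (*-identityʳ n) ⟩
    (n * (n * n)) ^ d           <⟨ ^-monoˡ-< d (*-monoʳ-< n (*-mono-< (n<1+n n) (n<1+n n))) ⟩
    (n * (suc n * suc n)) ^ d   ∎
... | m , m<1+n , fits , ¬fits = m , ≮⇒≥ u≮m , s≤s⁻¹ m<1+n , fits , ≰⇒> ¬fits
  where
  open ≤-Reasoning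
  -- Here s > 2 enters through 2d ≤ a: blocks of size about √n are affordable.
  u≮m : ¬ m < u
  u≮m m<u = ¬fits (begin
    (n * (suc m * suc m)) ^ d   ≤⟨ ^-monoˡ-≤ d (*-monoʳ-≤ n (≤-trans (*-mono-≤ m<u m<u) u²≤n)) ⟩
    (n * n) ^ d                 ≡⟨ cong (λ y → (n * y) ^ d) (*-identityʳ n) ⟨
    (n ^ 2) ^ d                 ≡⟨ ^-*-assoc n 2 d ⟩
    n ^ (2 * d)                 ≤⟨ ^-monoʳ-≤ n 2d≤a ⟩
    n ^ a                       ∎)

-- From the good form to the theorem

varies⇒nonconstant : ∀ {n D k} {E : Pred (𝔽₂^ n) 0ℓ} (f : 𝔽₂^ n → 𝔽₂) →
  (∀ a (vs : Vec (𝔽₂^ n) D) → LinearlyIndependent vs →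
    ∃[ c ] ∃[ d ] f (a ⊕ combination c vs) ≢ f (a ⊕ combination d vs)) →
  D ≤ k → IsFlat k E → NonconstantOn E f
varies⇒nonconstant f varies D≤k (a , vs , li , members) with independent-subfamily D≤k vs li
... | ws , li′ , span with varies a ws li′
...   | c , d , neq = _ , _ , member c , member d , neq
  where
  member = λ c → Equivalence.from (members (a ⊕ combination c ws))
    (proj₁ (span c) , cong (a ⊕_) (proj₂ (span c)))

612/100-cancel : ∀ D → (+ 612 / 100) ℚ.* (+ (25 * D) / 153) ≡ + D / 1
612/100-cancel D = trans (/-* 612 100 (25 * D) 153) (/-≡ (612 * (25 * D)) (100 * 153) D 1 (lemma D))
  where
  lemma : ∀ D → 612 * (25 * D) * 1 ≡ D * (100 * 153)
  lemma = solve-∀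

CubicDisperser : Cut → (n : ℕ) .{{_ : NonZero n}} → Set₁
CubicDisperser s n = Σ (𝔽₂^ n → 𝔽₂) λ f →
  degree f ≡ 3 ×
  (∃[ t ] IsThickness f t × fromℕ t ≤ᶜ n ^ᶜ s) ×
  ((k : ℕ) (E : Pred (𝔽₂^ n) 0ℓ) → IsFlat k E →
    (+ 612 / 100) ·ᶜ n ^ᶜ (fromℕ 2 -ᶜ ½ ·ᶜ s) ≤ᶜ fromℕ k →
    NonconstantOn E f)

dimension-large : ∀ s n .{{_ : NonZero n}} D k a g d .{{_ : NonZero d}} → g + (3 + a) ≡ 4 * d →
  upper s (+ (2 + a) / d) → (25 * D) ^ (2 * d) < n ^ g * 153 ^ (2 * d) →
  (+ 612 / 100) ·ᶜ n ^ᶜ (fromℕ 2 -ᶜ ½ ·ᶜ s) ≤ᶜ fromℕ k → D ≤ k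
dimension-large s n D k a g d exponents up bound le = <⇒≤ (subst₂ _<_ (*-identityʳ D) (*-identityʳ k)
  (/-<⁻¹ D 1 k 1 (subst (ℚ._< + k / 1) (612/100-cancel D)
    (le ((+ 612 / 100) ℚ.* w) (w , (r , exponent-below {s} a g d exponents up ,
      fraction-below-power n (25 * D) 153 g (2 * d) bound) , refl)))))
  where
  instance
    2d≢0 : NonZero (2 * d)
    2d≢0 = m*n≢0 2 d
  -- Chosen so that 6.12 w = D, which puts D into the lower cut of the dimension threshold.
  w = + (25 * D) / 153
  r = + g / (2 * d)

cubicDisperser : ∀ s → IsReal s → fromℕ 2 <ᶜ s → s ≤ᶜ fromℕ 3 →
  ∀ n .{{_ : NonZero n}} d .{{_ : NonZero d}} → 3 ≤ d →
  n ^ 3 * 100 ^ (2 * d) ≤ 101 ^ (2 * d) → 101 * 101 ≤ n → CubicDisperser s n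
cubicDisperser s real 2<s s≤3 n d 3≤d cube-small N≤n =
  let u , u²≤n , n<[1+u]² = isqrt n
      a , 2d≤a , a<3d , a/d<s , s<[2+a]/d = bracket {s} real 2<s s≤3 d
      m , u≤m , m≤n , fits , overshoots = block-size n d a u u²≤n 2d≤a a<3d
  in construct u u²≤n n<[1+u]² a a<3d a/d<s s<[2+a]/d m u≤m m≤n fits overshoots
  where
  construct : ∀ u → u * u ≤ n → n < suc u * suc u →
    ∀ a → a < 3 * d → lower s (+ a / d) → upper s (+ (2 + a) / d) →
    ∀ m → u ≤ m → m ≤ n → (n * (m * m)) ^ d ≤ n ^ a → n ^ a < (n * (suc m * suc m)) ^ d →
    CubicDisperser s n
  construct u u²≤n n<[1+u]² a a<3d a/d<s s<[2+a]/d m u≤m m≤n fits overshoots =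
    let c , (S , cS) , varies = good-form B (3 * u) (λ i i<n → s≤s (/-monoˡ-≤ m (<⇒≤ i<n)))
                                  (few-flats u B (≤-trans (m≤m+n 8 93) 101≤u) n<[1+u]²) some-triple
        t , thickness , t≤ = thickness-exists (form c)
        small : t ^ d ≤ n ^ a
        small = ≤-trans (^-monoˡ-≤ d (≤-trans t≤ (sparsity-form c (form c ∘ apply (identityBijection n))
                  (λ x → cong (form c) (affine-identity x))))) fits
    in form c , degree-form c S cS ,
      (t , thickness , λ q q<t → + a / d , a/d<s , below-power n t a d small q q<t) ,
      λ k E flat le → varies⇒nonconstant {E = E} (form c) varies
        (dimension-large s n D k a g d exponents s<[2+a]/d
          (dimension-bound n m u a g d cube-small 101≤u u≤m m≤n u²≤n exponents overshoots) le) flat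
    where
    101≤u : 101 ≤ u
    101≤u = ≮⇒≥ λ u<101 → <⇒≱ n<[1+u]² (≤-trans (*-mono-≤ u<101 u<101) N≤n)
    101≤m : 101 ≤ m
    101≤m = ≤-trans 101≤u u≤m
    3≤m : 3 ≤ m
    3≤m = ≤-trans (m≤m+n 3 98) 101≤m
    instance
      m≢0 : NonZero m
      m≢0 = >-nonZero (≤-trans (s≤s z≤n) 101≤m)
    B = suc (n ℕ./ m)
    D = B * (3 * u)
    -- The subtraction is exact, as 3 ≤ d and a < 3d.
    g = 4 * d ∸ (3 + a)
    exponents : g + (3 + a) ≡ 4 * d
    exponents = m∸n+n≡m (+-mono-≤ 3≤d (<⇒≤ a<3d))
    open Blocks m
    open Forms n
    colour-0 : ∀ i → i ≤ 2 → i ℕ./ m ≡ 0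
    colour-0 i i≤2 = m<n⇒m/n≡0 (≤-trans (s≤s i≤2) 3≤m)
    some-triple : ∃[ S ] triple {n} S ≡ true
    some-triple = subst (λ n → ∃[ S ] triple {n} S ≡ true) (m∸n+n≡m (≤-trans 3≤m m≤n))
      (triple-exists (trans (colour-0 1 (s≤s z≤n)) (sym (colour-0 2 ≤-refl)))
        (trans (colour-0 0 z≤n) (sym (colour-0 2 ≤-refl))) (n ∸ 3))

theorem6 : (s : Cut) → IsReal s → fromℕ 2 <ᶜ s → s ≤ᶜ fromℕ 3 →
    Σ ℕ λ N → (n : ℕ) → .{{_ : NonZero n}} → N ≤ n →
    Σ (𝔽₂^ n → 𝔽₂) λ f →
    degree f ≡ 3 ×
    (∃[ t ] IsThickness f t × fromℕ t ≤ᶜ n ^ᶜ s) ×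
    ((k : ℕ) (E : Pred (𝔽₂^ n) 0ℓ) → IsFlat k E →
    (+ 612 / 100) ·ᶜ n ^ᶜ (fromℕ 2 -ᶜ ½ ·ᶜ s) ≤ᶜ fromℕ k →
    NonconstantOn E f)
theorem6 s real 2<s s≤3 = 101 * 101 , λ n N≤n →
  -- With d = 150 n the factor 1.01^(2d) = 1.01^(300 n) outgrows n³ for every s. The threshold 101²
  -- makes the integer square root u at least 101, and u ≤ m passes this on to the block size.
  cubicDisperser s real 2<s s≤3 n (150 * n) {{m*n≢0 150 n}}
    (≤-trans (m≤m+n 3 147) (m≤m*n 150 n)) (cube-small n) N≤n
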